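{- Let $b,r\ge1$ and let $S$ be a standard skew tableau with exactly $b$ rows, each of size $r$. For $i=1,\dots,b$ let $w_i$ be the word formed by the entries of the $i$-th row of $S$ counted from the bottom, read left to right. For $i=1,\dots,b-1$ let $c_i=\ell_1(P(w_iw_{i+1}))-r$, where $P(w_iw_{i+1})$ is the Schensted insertion tableau of the concatenated word $w_iw_{i+1}$ and $\ell_1$ denotes the length of its first row. Then for every integer $k\ge b-1$, $\mathrm{Rect}(S^{(k)})$ has shape $(\lambda_1,\dots,\lambda_b)$ (parts possibly zero) where $$\lambda_j=kr+\sum_{i=1}^{b-j}c_i-\sum_{i=1}^{j-1}c_i\quad\text{for all } j=1,\dots,b.$$
   Context: Tableaux use English notation. A standard skew tableau of size $m$ is a filling of a skew shape with $1,\dots,m$, each once, increasing along rows and down columns. $S+x$ adds $x$ to every entry. $\mathrm{Rect}(S)$ is the jeu de taquin rectification of $S$, equivalently the Schensted row-insertion tableau of the reading word of $S$ (rows read left to right, from bottom row to top row). For $S$ of size $m$ with row sizes weakly decreasing from top to bottom and $k\ge1$, $S^{(k)}$ is the standard skew tableau whose $i$-th row (from the top) consists of the $i$-th row of $S$ followed immediately to the right by the $i$-th rows of $S+m,\dots,S+(k-1)m$; $S^{(0)}$ is the empty tableau. -}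

module Defs where

open import Data.Nat using (ℕ; zero; suc; _+_; _*_; _∸_; _≤_; _<_; _<ᵇ_)
open import Data.Integer as ℤ using (ℤ; +_)
open import Data.List using (List; []; _∷_; _++_; map; length; concat; reverse;
  foldl; replicate; take; drop; zipWith; sum; upTo; lookup)
open import Data.List.Relation.Unary.All using (All)
open import Data.List.Relation.Unary.Linked using (Linked)
open import Data.List.Relation.Binary.Permutation.Propositional using (_↭_)
open import Data.Maybe using (Maybe; just; nothing)
open import Data.Product using (_×_; _,_; proj₁; proj₂)
open import Data.Bool using (if_then_else_)
open import Relation.Binary.PropositionalEquality using (_≡_)

-- Skew tableaux (English notation)
-- A row is (offset, entries): the row occupies columns
-- offset, offset+1, ..., offset + length entries - 1 (columns 0-based).
-- A skew tableau is the list of its rows from TOP to BOTTOM.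
-- So the shape is λ/μ with μ_i = offset_i and λ_i = offset_i + length_i.

Row : Set
Row = ℕ × List ℕ

SkewTab : Set
SkewTab = List Row

cellAt : Row → ℕ → Maybe ℕ
cellAt (o , xs) c = go o c xs
  where
  go : ℕ → ℕ → List ℕ → Maybe ℕ
  go zero    c       []       = nothing
  go zero    zero    (x ∷ xs) = just x
  go zero    (suc c) (x ∷ xs) = go zero c xs
  go (suc o) zero    xs       = nothing
  go (suc o) (suc c) xs       = go o c xs

rowEnd : Row → ℕ
rowEnd (o , xs) = o + length xs

entries : SkewTab → List ℕ
entries S = concat (map proj₂ S)

size : SkewTab → ℕ
size S = length (entries S)

data AdjRows (R₁ R₂ : Row) : Set where
  adjRows :
    proj₁ R₂ ≤ proj₁ R₁ →
    rowEnd R₂ ≤ rowEnd R₁ →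
    (∀ c x y → cellAt R₁ c ≡ just x → cellAt R₂ c ≡ just y → x < y) →
    AdjRows R₁ R₂

record IsStandardSkew (S : SkewTab) : Set where
  field
    shapeAndColumns : Linked AdjRows S
    rowsIncreasing  : All (λ R → Linked _<_ (proj₂ R)) S
    filling         : entries S ↭ map suc (upTo (size S))

Tableau : Set
Tableau = List (List ℕ)

bumpRow : ℕ → List ℕ → List ℕ × Maybe ℕ
bumpRow x []       = x ∷ [] , nothing
bumpRow x (y ∷ ys) with x <ᵇ y
... | Data.Bool.true  = x ∷ ys , just y
... | Data.Bool.false with bumpRow x ys
...   | ys' , z = y ∷ ys' , z

insertT : ℕ → Tableau → Tableau
insertT x []          = (x ∷ []) ∷ []
insertT x (row ∷ rest) with bumpRow x row
... | row' , nothing = row' ∷ rest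
... | row' , just y  = row' ∷ insertT y rest

P : List ℕ → Tableau
P w = foldl (λ T x → insertT x T) [] w

shape : Tableau → List ℕ
shape T = map length T

firstRowLength : Tableau → ℕ
firstRowLength []      = 0
firstRowLength (x ∷ _) = length x

readingWord : SkewTab → List ℕ
readingWord S = concat (reverse (map proj₂ S))

Rect : SkewTab → Tableau
Rect S = P (readingWord S)

shiftRow : ℕ → List ℕ → List ℕ
shiftRow a xs = map (λ x → a + x) xs

power : ℕ → SkewTab → SkewTab
power k S = map (λ R → proj₁ R , concat (map (λ j → shiftRow (j * size S) (proj₂ R)) (upTo k))) S

wordsBottomUp : SkewTab → List (List ℕ)
wordsBottomUp S = reverse (map proj₂ S)

cs : ℕ → SkewTab → List ℤ
cs r S = zipWith (λ u v → + firstRowLength (P (u ++ v)) ℤ.- + r)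
                 (wordsBottomUp S) (drop 1 (wordsBottomUp S))

sumFirst : ℕ → List ℤ → ℤ
sumFirst n xs = Data.List.foldr ℤ._+_ (+ 0) (take n xs)

-- (λ_1, …, λ_b), λ_j = kr + Σ_{i=1}^{b-j} c_i − Σ_{i=1}^{j-1} c_i
-- (here j' = j - 1 ranges over 0, …, b-1)
lambdas : ℕ → ℕ → ℕ → SkewTab → List ℤ
lambdas b r k S =
  map (λ j' → (+ (k * r) ℤ.+ sumFirst (b ∸ 1 ∸ j') (cs r S)) ℤ.- sumFirst j' (cs r S))
      (upTo b)

paddedShape : ℕ → Tableau → List ℤ
paddedShape b T = map +_ (shape T) ++ replicate (b ∸ length T) (+ 0)

{-# OPTIONS --safe #-}

-- Inserting the rows from the bottom up, the word X entering a tableau row R behaves like the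
-- arrivals at a queue with services R: the bumped letters are the departures, and the new row
-- consists of the arrivals and the unused services.  So all row lengths are read off the counting
-- functions v ↦ #{x < v}, and the bumped word has the counting function
-- min over u ≤ v of X(u) + R(v) − R(u).  In a periodic regime with equally many letters per period
-- all services get used, so row and word just exchange, up to a constant: after a transient phase,
-- row j (from 0) has the counting function of the word inserted j steps before the last one, plus
-- a constant which is a difference of sums of the cᵢ.  Two bounds hold at all times, including the
-- transient phase: if two consecutive words enter the same row, the earlier never exceeds the later
-- by more than their cᵢ, and hence a row R never exceeds the word entering it by more than the sum
-- of the cᵢ since that row came into being.  The minimum above is therefore final as soon as it
-- reaches this bound, which happens once the points where the cᵢ are attained have been visited in
-- increasing order of i; this takes at most b − 1 periods.

module Submission where

open import Defs
open import Data.Bool using (true; false)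
open import Data.Integer as ℤ using (ℤ; +_)
import Data.Integer.Properties as ℤₚ
open import Data.Integer.Tactic.RingSolver using (solve-∀)
open import Data.List using (List; []; _∷_; _++_; length; concat; foldl; map; upTo; applyUpTo;
  take; drop; zipWith; reverse)
import Data.List.Properties as Listₚ
open import Data.List.Relation.Binary.Permutation.Propositional as Perm using (_↭_)
import Data.List.Relation.Binary.Permutation.Propositional.Properties as Permₚ
open import Data.List.Relation.Unary.All as All using (All; []; _∷_)
import Data.List.Relation.Unary.All.Properties as Allₚ
open import Data.List.Relation.Unary.AllPairs as AllPairs using (AllPairs; []; _∷_)
import Data.List.Relation.Unary.AllPairs.Properties as AllPairsₚ
import Data.List.Relation.Unary.Linked.Properties as Linkedₚ
open import Data.Maybe using (just; nothing)
open import Data.Nat using (ℕ; zero; suc; _≤_; _<_; _∸_; _+_; _*_; z≤n; s≤s; _≤?_; _<?_; _<ᵇ_)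
import Data.Nat.Properties as ℕₚ
open import Data.Product using (_×_; _,_; proj₁; proj₂; ∃-syntax)
open import Data.Unit using (tt)
open import Relation.Nullary using (Dec; yes; no; contradiction)
open import Relation.Binary.PropositionalEquality

-- Linear inequalities are proved by adding up the hypotheses with _⊕_ below and comparing the
-- differences of both sides by ring normalisation.
≤-from-diff : ∀ {a b c d : ℤ} → a ℤ.≤ b → d ℤ.- c ≡ b ℤ.- a → c ℤ.≤ d
≤-from-diff {a} {b} h e = ℤₚ.0≤i-j⇒j≤i (subst (+ 0 ℤ.≤_) (sym e) (ℤₚ.i≤j⇒0≤j-i h))

-- Counting functions

Sorted : List ℕ → Set
Sorted = AllPairs _≤_

-- Integer values, so that counts can be subtracted in the inequalities below.
lt : ℕ → ℕ → ℤ
lt x       zero    = + 0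
lt zero    (suc v) = + 1
lt (suc x) (suc v) = lt x v

cnt : List ℕ → ℕ → ℤ
cnt []       v = + 0
cnt (x ∷ xs) v = lt x v ℤ.+ cnt xs v

lt-true : ∀ {x v} → x < v → lt x v ≡ + 1
lt-true {zero}  {suc v} _       = refl
lt-true {suc x} {suc v} (s≤s h) = lt-true h

lt-false : ∀ {x v} → v ≤ x → lt x v ≡ + 0
lt-false {x}     {zero}  _       = refl
lt-false {suc x} {suc v} (s≤s h) = lt-false h

lt-mono : ∀ x {u v} → u ≤ v → lt x u ℤ.≤ lt x v
lt-mono x       {zero}  {zero}  _       = ℤₚ.≤-refl
lt-mono zero    {zero}  {suc v} _       = ℤ.+≤+ z≤n
lt-mono (suc x) {zero}  {suc v} _       = lt-mono x {zero} {v} z≤n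
lt-mono zero    {suc u} {suc v} _       = ℤₚ.≤-refl
lt-mono (suc x) {suc u} {suc v} (s≤s h) = lt-mono x h

lt-anti : ∀ {x y} v → x ≤ y → lt y v ℤ.≤ lt x v
lt-anti                  zero    _       = ℤₚ.≤-refl
lt-anti {zero}  {zero}   (suc v) _       = ℤₚ.≤-refl
lt-anti {zero}  {suc y}  (suc v) _       = lt≤1 y v
  where
  lt≤1 : ∀ y v → lt y v ℤ.≤ + 1
  lt≤1 y       zero    = ℤ.+≤+ z≤n
  lt≤1 zero    (suc v) = ℤₚ.≤-refl
  lt≤1 (suc y) (suc v) = lt≤1 y v
lt-anti {suc x} {suc y}  (suc v) (s≤s h) = lt-anti v h

cnt-zero : ∀ xs → cnt xs 0 ≡ + 0
cnt-zero []       = refl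
cnt-zero (x ∷ xs) = trans (ℤₚ.+-identityˡ _) (cnt-zero xs)

cnt-mono : ∀ xs {u v} → u ≤ v → cnt xs u ℤ.≤ cnt xs v
cnt-mono []       h = ℤₚ.≤-refl
cnt-mono (x ∷ xs) h = ℤₚ.+-mono-≤ (lt-mono x h) (cnt-mono xs h)

cnt-nonneg : ∀ xs v → + 0 ℤ.≤ cnt xs v
cnt-nonneg xs v = subst (ℤ._≤ cnt xs v) (cnt-zero xs) (cnt-mono xs z≤n)

cnt-none : ∀ {xs v} → All (v ≤_) xs → cnt xs v ≡ + 0
cnt-none []       = refl
cnt-none (h ∷ hs) = cong₂ ℤ._+_ (lt-false h) (cnt-none hs)

cnt-all : ∀ {xs v} → All (_< v) xs → cnt xs v ≡ + length xs
cnt-all []       = refl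
cnt-all (h ∷ hs) = cong₂ ℤ._+_ (lt-true h) (cnt-all hs)

-- One weakly increasing word entering one row

-- Ins R X R′ X′: inserting the weakly increasing word X into the row R leaves
-- the row R′ and bumps out the word X′.  Reading both lists from the left, each
-- letter of X displaces the next remaining larger entry of R.
data Ins : (R X R′ X′ : List ℕ) → Set where
  nilˡ : ∀ {xs} → Ins [] xs xs []
  nilʳ : ∀ {y ys} → Ins (y ∷ ys) [] (y ∷ ys) []
  keep : ∀ {y ys x xs rs zs} → y ≤ x → Ins ys (x ∷ xs) rs zs →
         Ins (y ∷ ys) (x ∷ xs) (y ∷ rs) zs
  bump : ∀ {y ys x xs rs zs} → x < y → Ins ys xs rs zs →
         Ins (y ∷ ys) (x ∷ xs) (x ∷ rs) (y ∷ zs)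

ins : ∀ R X → ∃[ R′ ] ∃[ X′ ] Ins R X R′ X′
ins []       xs       = xs , [] , nilˡ
ins (y ∷ ys) []       = y ∷ ys , [] , nilʳ
ins (y ∷ ys) (x ∷ xs) with y ≤? x
... | yes y≤x = let rs , zs , i = ins ys (x ∷ xs) in y ∷ rs , zs , keep y≤x i
... | no  y≰x = let rs , zs , i = ins ys xs in x ∷ rs , y ∷ zs , bump (ℕₚ.≰⇒> y≰x) i

Ins-All : ∀ {ℓ} {P : ℕ → Set ℓ} {R X R′ X′} → Ins R X R′ X′ →
          All P R → All P X → All P R′ × All P X′
Ins-All nilˡ       pr       px       = px , []
Ins-All nilʳ       pr       px       = pr , []
Ins-All (keep _ i) (p ∷ pr) px       = let a , b = Ins-All i pr px in p ∷ a , b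
Ins-All (bump _ i) (p ∷ pr) (q ∷ px) = let a , b = Ins-All i pr px in q ∷ a , p ∷ b

-- All bumped letters come from the row. This makes the bumped word sorted, whereas letters of `X`
-- may lie below one already bumped.
Ins-bumped-All : ∀ {ℓ} {P : ℕ → Set ℓ} {R X R′ X′} → Ins R X R′ X′ → All P R → All P X′
Ins-bumped-All nilˡ       pr       = []
Ins-bumped-All nilʳ       pr       = []
Ins-bumped-All (keep _ i) (_ ∷ pr) = Ins-bumped-All i pr
Ins-bumped-All (bump _ i) (p ∷ pr) = p ∷ Ins-bumped-All i pr

Ins-sorted : ∀ {R X R′ X′} → Ins R X R′ X′ → Sorted R → Sorted X → Sorted R′ × Sorted X′
Ins-sorted nilˡ sr sx = sx , []
Ins-sorted nilʳ sr sx = sr , []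
Ins-sorted (keep y≤x i) (y≤ys ∷ sr) sx@(x≤xs ∷ _) =
  let a , b = Ins-sorted i sr sx
      c , _ = Ins-All i y≤ys (y≤x ∷ All.map (ℕₚ.≤-trans y≤x) x≤xs)
  in c ∷ a , b
Ins-sorted (bump x<y i) (y≤ys ∷ sr) (x≤xs ∷ sx) =
  let a , b = Ins-sorted i sr sx
      c , _ = Ins-All i (All.map (ℕₚ.≤-trans (ℕₚ.<⇒≤ x<y)) y≤ys) x≤xs
  in c ∷ a , Ins-bumped-All i y≤ys ∷ b

Ins-conserves : ∀ {R X R′ X′} → Ins R X R′ X′ → ∀ v →
                cnt R′ v ℤ.+ cnt X′ v ≡ cnt R v ℤ.+ cnt X v
Ins-conserves (nilˡ {xs}) v = ℤₚ.+-comm (cnt xs v) (+ 0)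
Ins-conserves nilʳ v = refl
Ins-conserves (keep {y} _ i) v =
  trans (ℤₚ.+-assoc (lt y v) _ _)
    (trans (cong (ℤ._+_ (lt y v)) (Ins-conserves i v)) (sym (ℤₚ.+-assoc (lt y v) _ _)))
Ins-conserves (bump {y} {ys} {x} {xs} {rs} {zs} _ i) v =
  trans (swap (lt x v) (cnt rs v) (lt y v) (cnt zs v))
    (trans (cong (ℤ._+_ (lt x v ℤ.+ lt y v)) (Ins-conserves i v))
      (swap′ (lt x v) (lt y v) (cnt ys v) (cnt xs v)))
  where
  swap : ∀ a r b z → (a ℤ.+ r) ℤ.+ (b ℤ.+ z) ≡ (a ℤ.+ b) ℤ.+ (r ℤ.+ z)
  swap = solve-∀
  swap′ : ∀ a b r x → (a ℤ.+ b) ℤ.+ (r ℤ.+ x) ≡ (b ℤ.+ r) ℤ.+ (a ℤ.+ x)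
  swap′ = solve-∀

-- The bumped word is a subword of `R`: between `u` and `v` there are at most as many departures as
-- services.
Ins-increments : ∀ {R X R′ X′} → Ins R X R′ X′ → ∀ {u v} → u ≤ v →
                 cnt X′ v ℤ.+ cnt R u ℤ.≤ cnt X′ u ℤ.+ cnt R v
Ins-increments nilˡ h = ℤₚ.≤-refl
Ins-increments (nilʳ {y} {ys}) h = ℤₚ.+-monoʳ-≤ (+ 0) (cnt-mono (y ∷ ys) h)
Ins-increments (keep {y} {ys} {rs = rs} {zs} _ i) {u} {v} h =
  ≤-from-diff (ℤₚ.+-mono-≤ (Ins-increments i h) (lt-mono y h))
    (eq (cnt zs v) (cnt ys u) (cnt zs u) (cnt ys v) (lt y u) (lt y v))
  where
  eq : ∀ zv ru zu rv yu yv →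
       (zu ℤ.+ (yv ℤ.+ rv)) ℤ.- (zv ℤ.+ (yu ℤ.+ ru)) ≡ ((zu ℤ.+ rv) ℤ.+ yv) ℤ.- ((zv ℤ.+ ru) ℤ.+ yu)
  eq = solve-∀
Ins-increments (bump {y} {ys} {rs = rs} {zs} _ i) {u} {v} h =
  ≤-from-diff (Ins-increments i h)
    (eq (cnt zs v) (cnt ys u) (cnt zs u) (cnt ys v) (lt y u) (lt y v))
  where
  eq : ∀ zv ru zu rv yu yv →
       ((yu ℤ.+ zu) ℤ.+ (yv ℤ.+ rv)) ℤ.- ((yv ℤ.+ zv) ℤ.+ (yu ℤ.+ ru)) ≡ (zu ℤ.+ rv) ℤ.- (zv ℤ.+ ru)
  eq = solve-∀

-- Each bumped letter exceeds the letter of `X` that bumps it: no departure precedes its arrival.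
Ins-dominated : ∀ {R X R′ X′} → Ins R X R′ X′ → ∀ v → cnt X′ v ℤ.≤ cnt X v
Ins-dominated (nilˡ {xs}) v = cnt-nonneg xs v
Ins-dominated nilʳ v = ℤₚ.≤-refl
Ins-dominated (keep _ i) v = Ins-dominated i v
Ins-dominated (bump x<y i) v = ℤₚ.+-mono-≤ (lt-anti v (ℕₚ.<⇒≤ x<y)) (Ins-dominated i v)

-- No value occurs twice in R and X together.
Simple : (R X : List ℕ) → Set
Simple R X = ∀ v → cnt R (suc v) ℤ.+ cnt X (suc v) ℤ.≤ (cnt R v ℤ.+ cnt X v) ℤ.+ + 1

Simple-tailˡ : ∀ {y} R X → Simple (y ∷ R) X → Simple R X
Simple-tailˡ {y} R X s v =
  ≤-from-diff (ℤₚ.+-mono-≤ (s v) (lt-mono y (ℕₚ.n≤1+n v)))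
    (eq (cnt R (suc v)) (cnt X (suc v)) (cnt R v) (cnt X v) (lt y v) (lt y (suc v)))
  where
  eq : ∀ r x r₀ x₀ y₀ y → ((r₀ ℤ.+ x₀) ℤ.+ + 1) ℤ.- (r ℤ.+ x) ≡
       ((((y₀ ℤ.+ r₀) ℤ.+ x₀) ℤ.+ + 1) ℤ.+ y) ℤ.- (((y ℤ.+ r) ℤ.+ x) ℤ.+ y₀)
  eq = solve-∀

Simple-tailʳ : ∀ {x} R X → Simple R (x ∷ X) → Simple R X
Simple-tailʳ {y} R X s v =
  ≤-from-diff (ℤₚ.+-mono-≤ (s v) (lt-mono y (ℕₚ.n≤1+n v)))
    (eq (cnt R (suc v)) (cnt X (suc v)) (cnt R v) (cnt X v) (lt y v) (lt y (suc v)))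
  where
  eq : ∀ r x r₀ x₀ y₀ y → ((r₀ ℤ.+ x₀) ℤ.+ + 1) ℤ.- (r ℤ.+ x) ≡
       (((r₀ ℤ.+ (y₀ ℤ.+ x₀)) ℤ.+ + 1) ℤ.+ y) ℤ.- ((r ℤ.+ (y ℤ.+ x)) ℤ.+ y₀)
  eq = solve-∀

nonneg-sum-zero : ∀ {a b : ℤ} → + 0 ℤ.≤ a → + 0 ℤ.≤ b → a ℤ.+ b ℤ.≤ + 0 → a ≡ + 0 × b ≡ + 0
nonneg-sum-zero {a} {b} ha hb h =
  ℤₚ.≤-antisym (≤-from-diff (ℤₚ.+-mono-≤ h hb) (eq a b)) ha ,
  ℤₚ.≤-antisym (≤-from-diff (ℤₚ.+-mono-≤ h ha) (eq′ a b)) hb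
  where
  eq : ∀ a b → + 0 ℤ.- a ≡ (+ 0 ℤ.+ b) ℤ.- ((a ℤ.+ b) ℤ.+ + 0)
  eq = solve-∀
  eq′ : ∀ a b → + 0 ℤ.- b ≡ (+ 0 ℤ.+ a) ℤ.- ((a ℤ.+ b) ℤ.+ + 0)
  eq′ = solve-∀

-- With Ins-increments and Ins-dominated: cnt X′ v = min over u ≤ v of cnt X u + cnt R v − cnt R u,
-- the departure process of a queue with arrivals X and services R.
Ins-attained : ∀ {R X R′ X′} → Ins R X R′ X′ → Sorted R → Sorted X → Simple R X → ∀ v →
               ∃[ u ] u ≤ v × cnt X′ v ℤ.+ cnt R u ≡ cnt X u ℤ.+ cnt R v
Ins-attained (nilˡ {xs}) _ _ _ v = 0 , z≤n , cong (ℤ._+ + 0) (sym (cnt-zero xs))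
Ins-attained nilʳ _ _ _ v = v , ℕₚ.≤-refl , refl
Ins-attained (keep {y} {ys} {x} {xs} {rs} {zs} y≤x i) (y≤ys ∷ sr) sx@(x≤xs ∷ _) s v
  with Ins-attained i sr sx (Simple-tailˡ ys (x ∷ xs) s) v
... | u , u≤v , e = cases (y <? u) (y <? v)
  where
  extend : ∀ {u l l′ a b} → cnt zs v ℤ.+ a ≡ cnt (x ∷ xs) u ℤ.+ b → l ≡ l′ →
           cnt zs v ℤ.+ (l ℤ.+ a) ≡ cnt (x ∷ xs) u ℤ.+ (l′ ℤ.+ b)
  extend {u} {l} {_} {a} {b} e refl =
    trans (swap (cnt zs v) l a) (trans (cong (ℤ._+_ l) e) (sym (swap (cnt (x ∷ xs) u) l b)))
    where
    swap : ∀ z l a → z ℤ.+ (l ℤ.+ a) ≡ l ℤ.+ (z ℤ.+ a)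
    swap = solve-∀
  cases : Dec (y < u) → Dec (y < v) →
          ∃[ u ] u ≤ v × cnt zs v ℤ.+ cnt (y ∷ ys) u ≡ cnt (x ∷ xs) u ℤ.+ cnt (y ∷ ys) v
  cases (yes y<u) _ =
    u , u≤v , extend {u} e (trans (lt-true y<u) (sym (lt-true (ℕₚ.<-≤-trans y<u u≤v))))
  cases (no y≮u) (no y≮v) =
    u , u≤v , extend {u} e (trans (lt-false (ℕₚ.≮⇒≥ y≮u)) (sym (lt-false (ℕₚ.≮⇒≥ y≮v))))
  cases (no y≮u) (yes y<v) =
    suc y , y<v , extend {suc y} e′ (trans (lt-true {y} ℕₚ.≤-refl) (sym (lt-true y<v)))
    where
    y≤xs : All (y ≤_) (x ∷ xs)
    y≤xs = y≤x ∷ All.map (ℕₚ.≤-trans y≤x) x≤xs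
    weaken : ∀ {l} → All (y ≤_) l → All (u ≤_) l
    weaken = All.map (ℕₚ.≤-trans (ℕₚ.≮⇒≥ y≮u))
    bound : cnt ys (suc y) ℤ.+ cnt (x ∷ xs) (suc y) ℤ.≤ + 0
    bound = ≤-from-diff (s y)
      (trans (eq (cnt ys (suc y)) (cnt (x ∷ xs) (suc y)))
        (cong₂ ℤ._-_
          (cong₂ (λ a b → (a ℤ.+ b) ℤ.+ + 1)
            (sym (cnt-none {y ∷ ys} (ℕₚ.≤-refl ∷ y≤ys))) (sym (cnt-none y≤xs)))
          (cong (λ a → (a ℤ.+ cnt ys (suc y)) ℤ.+ cnt (x ∷ xs) (suc y))
            (sym (lt-true {y} ℕₚ.≤-refl)))))
      where
      eq : ∀ a b → + 0 ℤ.- (a ℤ.+ b) ≡ + 1 ℤ.- ((+ 1 ℤ.+ a) ℤ.+ b)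
      eq = solve-∀
    both≡0 : cnt ys (suc y) ≡ + 0 × cnt (x ∷ xs) (suc y) ≡ + 0
    both≡0 = nonneg-sum-zero (cnt-nonneg ys (suc y)) (cnt-nonneg (x ∷ xs) (suc y)) bound
    e′ : cnt zs v ℤ.+ cnt ys (suc y) ≡ cnt (x ∷ xs) (suc y) ℤ.+ cnt ys v
    e′ = trans (cong (ℤ._+_ (cnt zs v)) (trans (proj₁ both≡0) (sym (cnt-none (weaken y≤ys)))))
           (trans e (cong (ℤ._+ cnt ys v)
             (trans (cnt-none (weaken y≤xs)) (sym (proj₂ both≡0)))))
Ins-attained (bump {y} {ys} {x} {xs} {rs} {zs} x<y i) (y≤ys ∷ sr) (x≤xs ∷ sx) s v
  with Ins-attained i sr sx (Simple-tailʳ ys xs (Simple-tailˡ ys (x ∷ xs) s)) v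
... | u , u≤v , e = cases (y <? u) (x <? u)
  where
  extend : ∀ {u l l′} → cnt zs v ℤ.+ cnt ys u ≡ cnt xs u ℤ.+ cnt ys v → l ≡ l′ →
           (lt y v ℤ.+ cnt zs v) ℤ.+ (l ℤ.+ cnt ys u) ≡ (l′ ℤ.+ cnt xs u) ℤ.+ (lt y v ℤ.+ cnt ys v)
  extend {u} {l} e refl =
    trans (swap (lt y v) (cnt zs v) l (cnt ys u))
      (trans (cong (ℤ._+_ (lt y v ℤ.+ l)) e) (swap′ (lt y v) l (cnt xs u) (cnt ys v)))
    where
    swap : ∀ a b c d → (a ℤ.+ b) ℤ.+ (c ℤ.+ d) ≡ (a ℤ.+ c) ℤ.+ (b ℤ.+ d)
    swap = solve-∀
    swap′ : ∀ a b c d → (a ℤ.+ b) ℤ.+ (c ℤ.+ d) ≡ (b ℤ.+ c) ℤ.+ (a ℤ.+ d)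
    swap′ = solve-∀
  cases : Dec (y < u) → Dec (x < u) →
          ∃[ u ] u ≤ v × (lt y v ℤ.+ cnt zs v) ℤ.+ cnt (y ∷ ys) u ≡ cnt (x ∷ xs) u ℤ.+ cnt (y ∷ ys) v
  cases (yes y<u) _ =
    u , u≤v , extend {u} e (trans (lt-true y<u) (sym (lt-true (ℕₚ.<-trans x<y y<u))))
  cases (no y≮u) (no x≮u) =
    u , u≤v , extend {u} e (trans (lt-false (ℕₚ.≮⇒≥ y≮u)) (sym (lt-false (ℕₚ.≮⇒≥ x≮u))))
  -- Here `x < u ≤ y`, so `u` counts `x` but not `y`. No letter of `ys` lies below `u`; then `e` and
  -- `Ins-increments` leave none of `xs` below `u` either, and the minimum is attained at 0 as well.
  cases (no y≮u) (yes x<u) = 0 , z≤n , extend {0} {+ 0} e₀ refl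
    where
    e₁ : cnt zs v ≡ cnt xs u ℤ.+ cnt ys v
    e₁ = trans (sym (ℤₚ.+-identityʳ _))
           (trans (cong (ℤ._+_ (cnt zs v))
             (sym (cnt-none (All.map (ℕₚ.≤-trans (ℕₚ.≮⇒≥ y≮u)) y≤ys)))) e)
    zs≤ys : cnt zs v ℤ.+ + 0 ℤ.≤ + 0 ℤ.+ cnt ys v
    zs≤ys = subst₂ (λ a b → cnt zs v ℤ.+ a ℤ.≤ b ℤ.+ cnt ys v) (cnt-zero ys) (cnt-zero zs)
              (Ins-increments i {0} {v} z≤n)
    xs≡0 : cnt xs u ≡ + 0
    xs≡0 = ℤₚ.≤-antisym
      (≤-from-diff zs≤ys (trans (eq (cnt xs u) (cnt ys v))
        (cong (λ a → (+ 0 ℤ.+ cnt ys v) ℤ.- (a ℤ.+ + 0)) (sym e₁))))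
      (cnt-nonneg xs u)
      where
      eq : ∀ a b → + 0 ℤ.- a ≡ (+ 0 ℤ.+ b) ℤ.- ((a ℤ.+ b) ℤ.+ + 0)
      eq = solve-∀
    e₀ : cnt zs v ℤ.+ cnt ys 0 ≡ cnt xs 0 ℤ.+ cnt ys v
    e₀ = trans (cong (ℤ._+_ (cnt zs v)) (cnt-zero ys))
           (trans (ℤₚ.+-identityʳ _) (trans e₁
             (cong (ℤ._+ cnt ys v) (trans xs≡0 (sym (cnt-zero xs))))))

-- Schensted insertion row by row

insertWord : Tableau → List ℕ → Tableau
insertWord = foldl (λ T x → insertT x T)

consFirst : ℕ → Tableau → Tableau
consFirst y []      = (y ∷ []) ∷ []
consFirst y (R ∷ T) = (y ∷ R) ∷ T

<ᵇ-true : ∀ {x y} → x < y → (x <ᵇ y) ≡ true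
<ᵇ-true {x} {y} h with x <ᵇ y | ℕₚ.<⇒<ᵇ h
... | true | _ = refl

<ᵇ-false : ∀ {x y} → y ≤ x → (x <ᵇ y) ≡ false
<ᵇ-false {x} {y} h with x <ᵇ y | ℕₚ.<ᵇ⇒< x y
... | false | _ = refl
... | true  | f = contradiction (f tt) (ℕₚ.≤⇒≯ h)

-- A leading entry is never bumped by a letter that is not smaller, so it is inert.
insertT-consFirst : ∀ {x y} → y ≤ x → ∀ T → insertT x (consFirst y T) ≡ consFirst y (insertT x T)
insertT-consFirst {x} {y} h [] rewrite <ᵇ-false h = refl
insertT-consFirst {x} {y} h (R ∷ T) rewrite <ᵇ-false h with bumpRow x R
... | _ , nothing = refl
... | _ , just _  = refl

insertWord-consFirst : ∀ {y} X → All (y ≤_) X → ∀ T →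
                       insertWord (consFirst y T) X ≡ consFirst y (insertWord T X)
insertWord-consFirst []      []       T = refl
insertWord-consFirst (x ∷ X) (h ∷ hs) T =
  trans (cong (λ T → insertWord T X) (insertT-consFirst h T)) (insertWord-consFirst X hs (insertT x T))

-- As `X` increases, the part of the row already passed is inert and splits off by `consFirst`. The
-- row does not depend on those below it, so the bumped letters can enter `T` afterwards, as one
-- word.
insertWord-Ins : ∀ {R X R′ X′} → Ins R X R′ X′ → Sorted X → ∀ T →
                 insertWord (R ∷ T) X ≡ R′ ∷ insertWord T X′
insertWord-Ins (nilˡ {[]}) _ T = refl
insertWord-Ins (nilˡ {x ∷ xs}) (x≤xs ∷ sx) T =
  trans (insertWord-consFirst xs x≤xs ([] ∷ T)) (cong (consFirst x) (insertWord-Ins nilˡ sx T))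
insertWord-Ins nilʳ _ T = refl
insertWord-Ins (keep {y} {ys} {x} {xs} y≤x i) sx@(x≤xs ∷ _) T =
  trans (insertWord-consFirst (x ∷ xs) (y≤x ∷ All.map (ℕₚ.≤-trans y≤x) x≤xs) (ys ∷ T))
    (cong (consFirst y) (insertWord-Ins i sx T))
insertWord-Ins (bump {y} {ys} {x} {xs} x<y i) (x≤xs ∷ sx) T rewrite <ᵇ-true x<y =
  trans (insertWord-consFirst xs x≤xs (ys ∷ insertT y T))
    (cong (consFirst x) (insertWord-Ins i sx (insertT y T)))

inserted bumped : List ℕ → List ℕ → List ℕ
inserted R X = proj₁ (ins R X)
bumped   R X = proj₁ (proj₂ (ins R X))

ins-Ins : ∀ R X → Ins R X (inserted R X) (bumped R X)
ins-Ins R X = proj₂ (proj₂ (ins R X))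

carry : (ℕ → List ℕ) → List ℕ → ℕ → List ℕ
carry f X zero    = X
carry f X (suc j) = bumped (f j) (carry f X j)

-- row W p is the tableau P (W 0 ⋯ W (p ∸ 1)), prolonged by empty rows.
row : (ℕ → List ℕ) → ℕ → ℕ → List ℕ
row W zero    j = []
row W (suc p) j = inserted (row W p j) (carry (row W p) (W p) j)

entering : (ℕ → List ℕ) → ℕ → ℕ → List ℕ
entering W p = carry (row W p) (W p)

row-Ins : ∀ W p j → Ins (row W p j) (entering W p j) (row W (suc p) j) (entering W p (suc j))
row-Ins W p j = ins-Ins (row W p j) (entering W p j)

row-entering-sorted : ∀ {W} → (∀ p → Sorted (W p)) → ∀ p j →
                      Sorted (row W p j) × Sorted (entering W p j)
row-entering-sorted {W} sW p j = row-sorted p j , entering-sorted p j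
  where
  row-sorted : ∀ p j → Sorted (row W p j)
  entering-sorted : ∀ p j → Sorted (entering W p j)
  row-sorted zero    j = []
  row-sorted (suc p) j = proj₁ (Ins-sorted (row-Ins W p j) (row-sorted p j) (entering-sorted p j))
  entering-sorted p zero    = sW p
  entering-sorted p (suc j) = proj₂ (Ins-sorted (row-Ins W p j) (row-sorted p j) (entering-sorted p j))

row-All : ∀ {ℓ} {P : ℕ → Set ℓ} {W} → (∀ p → All P (W p)) → ∀ p j → All P (row W p j)
row-All {P = P} {W} aW = go
  where
  go : ∀ p j → All P (row W p j)
  go′ : ∀ p j → All P (entering W p j)
  go zero    j = []
  go (suc p) j = proj₁ (Ins-All (row-Ins W p j) (go p j) (go′ p j))
  go′ p zero    = aW p
  go′ p (suc j) = proj₂ (Ins-All (row-Ins W p j) (go p j) (go′ p j))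

-- A word entering an empty row stays there entirely, so each word opens at most one row.
row-empty : ∀ W {p j} → p ≤ j → row W p j ≡ []
entering-empty : ∀ W {p j} → p < j → entering W p j ≡ []
row-empty W {zero}  {j} _ = refl
row-empty W {suc p} {j} h
  rewrite row-empty W {p} {j} (ℕₚ.<⇒≤ h) | entering-empty W {p} {j} h = refl
entering-empty W {p} {suc j} (s≤s h) rewrite row-empty W {p} {j} h = refl

nth : ∀ {a} {A : Set a} → A → List A → ℕ → A
nth d []       _       = d
nth d (x ∷ xs) zero    = x
nth d (x ∷ xs) (suc i) = nth d xs i

-- Agreement up to trailing empty rows; the number of rows is bounded separately.
HasRows : Tableau → (ℕ → List ℕ) → Set
HasRows T f = ∀ j → nth [] T j ≡ f j

carry-suc : ∀ f X j → carry f X (suc j) ≡ carry (λ i → f (suc i)) (bumped (f 0) X) j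
carry-suc f X zero    = refl
carry-suc f X (suc j) = cong (bumped (f (suc j))) (carry-suc f X j)

carry-[] : ∀ {f} → (∀ j → [] ≡ f j) → ∀ X j → carry f X (suc j) ≡ []
carry-[] {f} h X j rewrite sym (h j) = refl

insertWord-[] : ∀ X → Sorted X → insertWord ([] ∷ []) X ≡ X ∷ []
insertWord-[] X sx = insertWord-Ins nilˡ sx []

insertWord-length : ∀ f → (∀ j → Sorted (f j)) → ∀ X → Sorted X → ∀ T → HasRows T f →
                    length (insertWord T X) ≤ suc (length T)
insertWord-length f sf []      _  []      _ = z≤n
insertWord-length f sf (x ∷ X) sx []      _ =
  ℕₚ.≤-reflexive (cong length (insertWord-[] (x ∷ X) sx))
insertWord-length f sf X       sx (R ∷ T) h rewrite insertWord-Ins (ins-Ins R X) sx T =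
  s≤s (insertWord-length (λ i → f (suc i)) (λ i → sf (suc i)) (bumped R X)
    (proj₂ (Ins-sorted (ins-Ins R X) (subst Sorted (sym (h 0)) (sf 0)) sx)) T (λ j → h (suc j)))

insertWord-HasRows : ∀ f → (∀ j → Sorted (f j)) → ∀ X → Sorted X → ∀ T → HasRows T f →
                     HasRows (insertWord T X) (λ j → inserted (f j) (carry f X j))
-- The empty word opens no row in the empty tableau, so the default of `nth` has to supply the empty
-- row here.
insertWord-HasRows f sf [] sx [] h zero rewrite sym (h 0) = refl
insertWord-HasRows f sf (x ∷ X) sx [] h zero
  rewrite sym (h 0) | insertWord-[] (x ∷ X) sx = refl
insertWord-HasRows f sf [] sx [] h (suc j)
  rewrite carry-[] h [] j | sym (h (suc j)) = refl
insertWord-HasRows f sf (x ∷ X) sx [] h (suc j)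
  rewrite carry-[] h (x ∷ X) j | sym (h (suc j)) | insertWord-[] (x ∷ X) sx = refl
insertWord-HasRows f sf X sx (R ∷ T) h j rewrite insertWord-Ins (ins-Ins R X) sx T = go j
  where
  go : HasRows (inserted R X ∷ insertWord T (bumped R X)) (λ j → inserted (f j) (carry f X j))
  go zero = cong (λ R → inserted R X) (h 0)
  go (suc j) =
    trans (insertWord-HasRows (λ i → f (suc i)) (λ i → sf (suc i)) (bumped R X)
      (proj₂ (Ins-sorted (ins-Ins R X) (subst Sorted (sym (h 0)) (sf 0)) sx)) T (λ j → h (suc j)) j)
      (cong (inserted (f (suc j)))
        (trans (cong (λ R → carry (λ i → f (suc i)) (bumped R X) j) (h 0)) (sym (carry-suc f X j))))

insertWords-rows : ∀ W → (∀ p → Sorted (W p)) → ∀ ws p T →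
                   (∀ i → i < length ws → nth [] ws i ≡ W (p + i)) →
                   HasRows T (row W p) → length T ≤ p →
                   HasRows (insertWord T (concat ws)) (row W (p + length ws)) ×
                   length (insertWord T (concat ws)) ≤ p + length ws
insertWords-rows W sW [] p T hw hT lT rewrite ℕₚ.+-identityʳ p = hT , lT
insertWords-rows W sW (X ∷ ws) p T hw hT lT
  rewrite Listₚ.foldl-++ (λ T x → insertT x T) T X (concat ws) | ℕₚ.+-suc p (length ws)
        | trans (hw 0 (s≤s z≤n)) (cong W (ℕₚ.+-identityʳ p)) =
  insertWords-rows W sW ws (suc p) (insertWord T (W p))
    (λ i i< → trans (hw (suc i) (s≤s i<)) (cong W (ℕₚ.+-suc p i)))
    (insertWord-HasRows (row W p) sorted (W p) (sW p) T hT)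
    (ℕₚ.≤-trans (insertWord-length (row W p) sorted (W p) (sW p) T hT) (s≤s lT))
  where
  sorted : ∀ j → Sorted (row W p j)
  sorted j = proj₁ (row-entering-sorted sW p j)

P-rows : ∀ W → (∀ p → Sorted (W p)) → ∀ ws → (∀ i → i < length ws → nth [] ws i ≡ W i) →
         HasRows (P (concat ws)) (row W (length ws)) × length (P (concat ws)) ≤ length ws
P-rows W sW ws hw = insertWords-rows W sW ws 0 [] hw (λ { zero → refl ; (suc _) → refl }) z≤n

-- The rows of the growing tableau: bounds at all times and the steady regime

_⊕_ : ∀ {a b c d : ℤ} → a ℤ.≤ b → c ℤ.≤ d → a ℤ.+ c ℤ.≤ b ℤ.+ d
_⊕_ = ℤₚ.+-mono-≤

infixl 5 _⊕_

sumTo : ℕ → (ℕ → ℤ) → ℤ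
sumTo zero    f = + 0
sumTo (suc n) f = sumTo n f ℤ.+ f n

-- Serves for the first `p` words and, with `row W p` as the family, for the top rows of a tableau.
total : (ℕ → List ℕ) → ℕ → ℕ → ℤ
total W p v = sumTo p (λ l → cnt (W l) v)

module RowInsertion (W : ℕ → List ℕ) where

  w : ℕ → ℕ → ℤ
  w p v = cnt (W p) v

  t x : ℕ → ℕ → ℕ → ℤ
  t p j v = cnt (row W p j) v
  x p j v = cnt (entering W p j) v

  conserves : ∀ p j v → t (suc p) j v ℤ.+ x p (suc j) v ≡ t p j v ℤ.+ x p j v
  conserves p j v = Ins-conserves (row-Ins W p j) v

  -- Conservation summed over the top `j` rows: `W p` goes in at the top and `entering W p j` comes
  -- out below.
  total-prefix : ∀ p j v → total (row W (suc p)) j v ℤ.+ x p j v ≡ w p v ℤ.+ total (row W p) j v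
  total-prefix p zero    v = ℤₚ.+-comm (+ 0) (w p v)
  total-prefix p (suc j) v =
    trans (swap (total (row W (suc p)) j v) (t (suc p) j v) (x p (suc j) v))
      (trans (cong (ℤ._+_ (total (row W (suc p)) j v)) (conserves p j v))
        (trans (swap′ (total (row W (suc p)) j v) (t p j v) (x p j v))
          (trans (cong (ℤ._+ t p j v) (total-prefix p j v))
            (ℤₚ.+-assoc (w p v) (total (row W p) j v) (t p j v)))))
    where
    swap : ∀ a b c → (a ℤ.+ b) ℤ.+ c ≡ a ℤ.+ (b ℤ.+ c)
    swap = solve-∀
    swap′ : ∀ a b c → a ℤ.+ (b ℤ.+ c) ≡ (a ℤ.+ c) ℤ.+ b
    swap′ = solve-∀

  total-[] : ∀ j v → total (row W 0) j v ≡ + 0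
  total-[] zero    v = refl
  total-[] (suc j) v = cong (ℤ._+ + 0) (total-[] j v)

  -- The top rows contain only letters of the words inserted so far, hence no value more often than
  -- these do.
  total-row-increments : ∀ p j v → total (row W p) j (suc v) ℤ.+ total W p v ℤ.≤
                                   total (row W p) j v ℤ.+ total W p (suc v)
  total-row-increments zero    j v =
    ℤₚ.≤-reflexive (cong (ℤ._+ + 0) (trans (total-[] j (suc v)) (sym (total-[] j v))))
  total-row-increments (suc p) j v =
    ≤-from-diff
      (total-row-increments p j v
        ⊕ ℤₚ.≤-reflexive (total-prefix p j (suc v))
        ⊕ ℤₚ.≤-reflexive (sym (total-prefix p j v))
        ⊕ cnt-mono (entering W p j) (ℕₚ.n≤1+n v))
      (eq (total (row W (suc p)) j (suc v)) (total (row W (suc p)) j v)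
        (total (row W p) j (suc v)) (total (row W p) j v) (x p j (suc v)) (x p j v)
        (total W p (suc v)) (total W p v) (w p (suc v)) (w p v))
    where
    eq : ∀ G G₀ H H₀ x x₀ T T₀ w w₀ →
         (G₀ ℤ.+ (T ℤ.+ w)) ℤ.- (G ℤ.+ (T₀ ℤ.+ w₀)) ≡
         ((((H₀ ℤ.+ T) ℤ.+ (w ℤ.+ H)) ℤ.+ (G₀ ℤ.+ x₀)) ℤ.+ x) ℤ.-
         ((((H ℤ.+ T₀) ℤ.+ (G ℤ.+ x)) ℤ.+ (w₀ ℤ.+ H₀)) ℤ.+ x₀)
    eq = solve-∀

  -- By `total-prefix`, the word entering row `j` consists of letters of `W p` and of the rows
  -- above. Together with row `j` it is therefore part of the first `suc p` words, which have no
  -- repetition.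
  row-entering-simple : ∀ p → (∀ v → total W (suc p) (suc v) ℤ.≤ total W (suc p) v ℤ.+ + 1) →
                        ∀ j → Simple (row W p j) (entering W p j)
  row-entering-simple p s j v =
    ≤-from-diff
      (s v
        ⊕ total-row-increments p (suc j) v
        ⊕ ℤₚ.≤-reflexive (total-prefix p j (suc v))
        ⊕ ℤₚ.≤-reflexive (sym (total-prefix p j v))
        ⊕ total-mono (row W (suc p)) j v)
      (eq (total (row W (suc p)) j (suc v)) (total (row W (suc p)) j v)
        (total (row W p) j (suc v)) (total (row W p) j v) (x p j (suc v)) (x p j v)
        (total W p (suc v)) (total W p v) (w p (suc v)) (w p v) (t p j (suc v)) (t p j v))
    where
    total-mono : ∀ W j v → total W j v ℤ.≤ total W j (suc v)
    total-mono W zero    v = ℤₚ.≤-refl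
    total-mono W (suc j) v = total-mono W j v ⊕ cnt-mono (W j) (ℕₚ.n≤1+n v)
    eq : ∀ G G₀ H H₀ x x₀ T T₀ w w₀ t t₀ →
         ((t₀ ℤ.+ x₀) ℤ.+ + 1) ℤ.- (t ℤ.+ x) ≡
         ((((((T₀ ℤ.+ w₀) ℤ.+ + 1) ℤ.+ ((H₀ ℤ.+ t₀) ℤ.+ T)) ℤ.+ (w ℤ.+ H)) ℤ.+ (G₀ ℤ.+ x₀)) ℤ.+ G) ℤ.-
         (((((T ℤ.+ w) ℤ.+ ((H ℤ.+ t) ℤ.+ T₀)) ℤ.+ (G ℤ.+ x)) ℤ.+ (w₀ ℤ.+ H₀)) ℤ.+ G₀)
    eq = solve-∀

  module Distinct (sorted : ∀ p → Sorted (W p))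
                  (distinct : ∀ p v → total W p (suc v) ℤ.≤ total W p v ℤ.+ + 1) where

    attained : ∀ p j v →
               ∃[ u ] u ≤ v × x p (suc j) v ℤ.+ t p j u ≡ x p j u ℤ.+ t p j v
    attained p j v =
      let sr , sx = row-entering-sorted sorted p j
      in Ins-attained (row-Ins W p j) sr sx (row-entering-simple p (distinct (suc p)) j) v

    -- The later word finds a row whose increment from `u` to `v` is at least that of the earlier
    -- entering word, by conservation and `Ins-increments`. At the minimising `u` this carries the
    -- bound from the entering words to the bumped ones.
    entering-gap : ∀ {p c} → (∀ u → w p u ℤ.≤ w (suc p) u ℤ.+ c) →
                   ∀ j v → x p j v ℤ.≤ x (suc p) j v ℤ.+ c
    entering-gap {p} {c} h zero    v = h v
    entering-gap {p} {c} h (suc j) v with attained (suc p) j v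
    ... | u , u≤v , e =
      ≤-from-diff
        (ℤₚ.≤-reflexive (sym e)
          ⊕ Ins-increments (row-Ins W p j) u≤v
          ⊕ ℤₚ.≤-reflexive (conserves p j u)
          ⊕ ℤₚ.≤-reflexive (sym (conserves p j v))
          ⊕ Ins-dominated (row-Ins W p j) v
          ⊕ entering-gap h j u)
        (eq (x (suc p) (suc j) v) (t (suc p) j u) (x (suc p) j u) (t (suc p) j v)
          (x p (suc j) v) (t p j u) (x p (suc j) u) (t p j v) (x p j u) (x p j v) c)
      where
      eq : ∀ y′v s_u yu sv x′v tu x′u tv xu xv c →
           (y′v ℤ.+ c) ℤ.- x′v ≡
           ((((((y′v ℤ.+ s_u) ℤ.+ (x′u ℤ.+ tv)) ℤ.+ (tu ℤ.+ xu)) ℤ.+ (sv ℤ.+ x′v)) ℤ.+ xv) ℤ.+ (yu ℤ.+ c)) ℤ.-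
           ((((((yu ℤ.+ sv) ℤ.+ (x′v ℤ.+ tu)) ℤ.+ (s_u ℤ.+ x′u)) ℤ.+ (tv ℤ.+ xv)) ℤ.+ x′v) ℤ.+ xu)
      eq = solve-∀

    -- C q stands for c₁ + ⋯ + c_q, so C (suc p) − C p belongs to the pair W p, W (suc p).
    module Gaps (C : ℕ → ℤ) (b : ℕ)
                (gap : ∀ p → suc p < b → ∀ u → w p u ℤ.≤ w (suc p) u ℤ.+ (C (suc p) ℤ.- C p)) where

      -- Row `j` is empty before word `j`. Afterwards, conservation and the minimising `u` give the
      -- new row at `v` as the entering word at `v` plus the old difference of row and word at `u`;
      -- `entering-gap` then passes to the next word.
      row-gap : ∀ j q → q + j < b → ∀ v →
                t (q + j) j v ℤ.≤ x (q + j) j v ℤ.+ (C (q + j) ℤ.- C j)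
      row-gap j zero    _ v rewrite row-empty W {j} {j} ℕₚ.≤-refl =
        ≤-from-diff (cnt-nonneg (entering W j j) v) (eq (x j j v) (C j))
        where
        eq : ∀ a c → (a ℤ.+ (c ℤ.- c)) ℤ.- + 0 ≡ a ℤ.- + 0
        eq = solve-∀
      row-gap j (suc q) h v with attained (q + j) j v
      ... | u , u≤v , e =
        ≤-from-diff
          (ℤₚ.≤-reflexive (sym e)
            ⊕ ℤₚ.≤-reflexive (conserves (q + j) j v)
            ⊕ row-gap j q (ℕₚ.<⇒≤ h) u
            ⊕ entering-gap (gap (q + j) h) j v)
          (eq (x (q + j) (suc j) v) (t (q + j) j u) (x (q + j) j u) (t (q + j) j v)
            (t (suc q + j) j v) (x (q + j) j v) (x (suc q + j) j v)
            (C (q + j)) (C (suc q + j)) (C j))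
        where
        eq : ∀ x′v tu xu tv sv xv yv c c′ d →
             (yv ℤ.+ (c′ ℤ.- d)) ℤ.- sv ≡
             ((((x′v ℤ.+ tu) ℤ.+ (tv ℤ.+ xv)) ℤ.+ (xu ℤ.+ (c ℤ.- d))) ℤ.+ (yv ℤ.+ (c′ ℤ.- c))) ℤ.-
             ((((xu ℤ.+ tv) ℤ.+ (sv ℤ.+ x′v)) ℤ.+ tu) ℤ.+ xv)
        eq = solve-∀

      -- In row `j`, the values from `τ q + j * m` on are past the transient phase of word `q`; each
      -- further row costs one period, which `τ-step` makes sufficient.
      module Steady (τ : ℕ → ℕ) (m : ℕ)
                    (τ-mono : ∀ q → τ q ≤ τ (suc q))
                    (τ-step : ∀ q → τ (suc q) ≤ τ q + m)
                    (tight : ∀ q j → suc q + j < b →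
                             w q (τ (suc q) + j * m) ≡
                             w (suc q) (τ (suc q) + j * m) ℤ.+ (C (suc q) ℤ.- C q)) where

        entering-steady : ∀ j q → q + j < b → ∀ v → τ q + j * m ≤ v →
                          x (q + j) j v ≡ w q v ℤ.+ (C q ℤ.- C (q + j))
        row-steady : ∀ j q → q + j < b → ∀ v → τ q + j * m ≤ v →
                     t (suc q + j) j v ≡ w q v ℤ.+ (C q ℤ.- C j)
        -- The minimum over `u` is bounded below by `row-gap`, and `tight` makes it reach this bound
        -- at the threshold, so it does not change afterwards.
        bumped-steady : ∀ j q → suc q + j < b → ∀ v → τ (suc q) + j * m ≤ v →
                        x (suc q + j) (suc j) v ≡ w q v ℤ.+ (C q ℤ.- C (suc q + j))

        entering-steady zero    q h v _ rewrite ℕₚ.+-identityʳ q = eq (w q v) (C q)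
          where
          eq : ∀ a c → a ≡ a ℤ.+ (c ℤ.- c)
          eq = solve-∀
        entering-steady (suc j) q h v θ≤v rewrite ℕₚ.+-suc q j =
          bumped-steady j q h v (ℕₚ.≤-trans (ℕₚ.+-monoˡ-≤ (j * m) (τ-step q))
            (subst (_≤ v) (sym (ℕₚ.+-assoc (τ q) m (j * m))) θ≤v))

        -- Word `j` opens row `j` and is placed there whole.
        row-steady j zero    h v θ≤v = begin
          t (suc j) j v                         ≡⟨ ℤₚ.+-identityʳ _ ⟨
          t (suc j) j v ℤ.+ + 0                 ≡⟨ cong (λ l → t (suc j) j v ℤ.+ cnt l v)
                                                     (entering-empty W {j} ℕₚ.≤-refl) ⟨
          t (suc j) j v ℤ.+ x j (suc j) v       ≡⟨ conserves j j v ⟩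
          t j j v ℤ.+ x j j v                   ≡⟨ cong (λ l → cnt l v ℤ.+ x j j v)
                                                     (row-empty W {j} ℕₚ.≤-refl) ⟩
          + 0 ℤ.+ x j j v                       ≡⟨ ℤₚ.+-identityˡ _ ⟩
          x j j v                               ≡⟨ entering-steady j 0 h v θ≤v ⟩
          w 0 v ℤ.+ (C 0 ℤ.- C j)               ∎
          where open ≡-Reasoning
        -- Row and word exchange: the bumped word has the old row's counting function up to a
        -- constant, so the new row has that of the entering word.
        row-steady j (suc q) h v θ≤v =
          trans (eq (t (suc (suc q) + j) j v) (x (suc q + j) (suc j) v)
                  (t (suc q + j) j v) (x (suc q + j) j v) (conserves (suc q + j) j v))
            (trans (cong₂ ℤ._-_
                (cong₂ ℤ._+_
                  (row-steady j q (ℕₚ.<⇒≤ h) v (ℕₚ.≤-trans (ℕₚ.+-monoˡ-≤ (j * m) (τ-mono q)) θ≤v))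
                  (entering-steady j (suc q) h v θ≤v))
                (bumped-steady j q h v θ≤v))
              (eq′ (w q v) (w (suc q) v) (C q) (C (suc q)) (C (suc q + j)) (C j)))
          where
          eq : ∀ a b c d → a ℤ.+ b ≡ c ℤ.+ d → a ≡ (c ℤ.+ d) ℤ.- b
          eq a b c d h = trans (cancel a b) (cong (ℤ._- b) h)
            where
            cancel : ∀ a b → a ≡ (a ℤ.+ b) ℤ.- b
            cancel = solve-∀
          eq′ : ∀ w w′ c c′ d e →
                ((w ℤ.+ (c ℤ.- e)) ℤ.+ (w′ ℤ.+ (c′ ℤ.- d))) ℤ.- (w ℤ.+ (c ℤ.- d)) ≡ w′ ℤ.+ (c′ ℤ.- e)
          eq′ = solve-∀

        bumped-steady j q h v θ≤v = ℤₚ.≤-antisym upper (lower (attained p j v))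
          where
          p θ : ℕ
          p = suc q + j
          θ = τ (suc q) + j * m
          rowAt : ∀ v → θ ≤ v → t p j v ≡ w q v ℤ.+ (C q ℤ.- C j)
          rowAt v h′ = row-steady j q (ℕₚ.<⇒≤ h) v (ℕₚ.≤-trans (ℕₚ.+-monoˡ-≤ (j * m) (τ-mono q)) h′)
          -- Whatever the minimising `u`, `row-gap` bounds entering word minus row at `u` from below
          -- by `C j ℤ.- C p`.
          lower : ∃[ u ] u ≤ v × x p (suc j) v ℤ.+ t p j u ≡ x p j u ℤ.+ t p j v →
                  w q v ℤ.+ (C q ℤ.- C p) ℤ.≤ x p (suc j) v
          lower (u , _ , e) =
            ≤-from-diff
              (ℤₚ.≤-reflexive (sym e) ⊕ row-gap j (suc q) h u ⊕ ℤₚ.≤-reflexive (sym (rowAt v θ≤v)))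
              (eq (x p (suc j) v) (t p j u) (x p j u) (t p j v) (w q v) (C q) (C p) (C j))
            where
            eq : ∀ x′v tu xu tv w c d e →
                 x′v ℤ.- (w ℤ.+ (c ℤ.- d)) ≡
                 (((x′v ℤ.+ tu) ℤ.+ (xu ℤ.+ (d ℤ.- e))) ℤ.+ tv) ℤ.- (((xu ℤ.+ tv) ℤ.+ tu) ℤ.+ (w ℤ.+ (c ℤ.- e)))
            eq = solve-∀
          -- At `θ` the steady forms of row and word, with `tight`, make this difference exactly
          -- `C j ℤ.- C p`.
          upper : x p (suc j) v ℤ.≤ w q v ℤ.+ (C q ℤ.- C p)
          upper =
            ≤-from-diff
              (Ins-increments (row-Ins W p j) θ≤v
                ⊕ Ins-dominated (row-Ins W p j) θ
                ⊕ ℤₚ.≤-reflexive (entering-steady j (suc q) h θ ℕₚ.≤-refl)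
                ⊕ ℤₚ.≤-reflexive (sym (rowAt θ ℕₚ.≤-refl))
                ⊕ ℤₚ.≤-reflexive (sym (tight q j h))
                ⊕ ℤₚ.≤-reflexive (rowAt v θ≤v))
              (eq (x p (suc j) v) (t p j θ) (x p (suc j) θ) (t p j v) (x p j θ)
                (w q θ) (w (suc q) θ) (w q v) (C q) (C (suc q)) (C p) (C j))
            where
            eq : ∀ x′v tθ x′θ tv xθ wθ w′θ wv c c′ d e →
                 (wv ℤ.+ (c ℤ.- d)) ℤ.- x′v ≡
                 ((((((x′θ ℤ.+ tv) ℤ.+ xθ) ℤ.+ (w′θ ℤ.+ (c′ ℤ.- d))) ℤ.+ tθ) ℤ.+ wθ) ℤ.+ (wv ℤ.+ (c ℤ.- e))) ℤ.-
                 ((((((x′v ℤ.+ tθ) ℤ.+ x′θ) ℤ.+ xθ) ℤ.+ (wθ ℤ.+ (c ℤ.- e))) ℤ.+ (w′θ ℤ.+ (c′ ℤ.- c))) ℤ.+ tv)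
            eq = solve-∀

-- Counting functions of concatenated, shifted and permuted lists

cnt-++ : ∀ xs ys v → cnt (xs ++ ys) v ≡ cnt xs v ℤ.+ cnt ys v
cnt-++ []       ys v = sym (ℤₚ.+-identityˡ _)
cnt-++ (x ∷ xs) ys v = trans (cong (ℤ._+_ (lt x v)) (cnt-++ xs ys v)) (sym (ℤₚ.+-assoc (lt x v) _ _))

-- Truncated subtraction is right here: for `v ≤ a` both counts vanish.
cnt-shift : ∀ a xs v → cnt (shiftRow a xs) v ≡ cnt xs (v ∸ a)
cnt-shift a []       v = refl
cnt-shift a (x ∷ xs) v = cong₂ ℤ._+_ (lt-shift a v) (cnt-shift a xs v)
  where
  lt-shift : ∀ a v → lt (a + x) v ≡ lt x (v ∸ a)
  lt-shift zero    v       = refl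
  lt-shift (suc a) zero    = refl
  lt-shift (suc a) (suc v) = lt-shift a v

cnt-↭ : ∀ {xs ys} → xs ↭ ys → ∀ v → cnt xs v ≡ cnt ys v
cnt-↭ Perm.refl         v = refl
cnt-↭ (Perm.prep x p)   v = cong (ℤ._+_ (lt x v)) (cnt-↭ p v)
cnt-↭ (Perm.swap {xs} {ys} x y p) v =
  trans (swap (lt x v) (lt y v) (cnt xs v)) (cong (λ c → lt y v ℤ.+ (lt x v ℤ.+ c)) (cnt-↭ p v))
  where
  swap : ∀ a b c → a ℤ.+ (b ℤ.+ c) ≡ b ℤ.+ (a ℤ.+ c)
  swap = solve-∀
cnt-↭ (Perm.trans p q)  v = trans (cnt-↭ p v) (cnt-↭ q v)

cnt-strict : ∀ {xs} → AllPairs _<_ xs → ∀ v → cnt xs (suc v) ℤ.≤ cnt xs v ℤ.+ + 1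
cnt-strict []                 v = ℤ.+≤+ z≤n
cnt-strict {x ∷ xs} (x<xs ∷ sx) v with x <? v
... | yes x<v rewrite lt-true x<v | lt-true (ℕₚ.m<n⇒m<1+n x<v) =
  subst (+ 1 ℤ.+ cnt xs (suc v) ℤ.≤_) (sym (ℤₚ.+-assoc (+ 1) (cnt xs v) (+ 1)))
    (ℤₚ.+-monoʳ-≤ (+ 1) (cnt-strict sx v))
... | no x≮v
  rewrite cnt-none {xs} {suc v} (All.map (ℕₚ.≤-trans (s≤s (ℕₚ.≮⇒≥ x≮v))) x<xs)
        | cnt-none {x ∷ xs} {v} (ℕₚ.≮⇒≥ x≮v ∷ All.map (λ x<y → ℕₚ.≤-trans (ℕₚ.≮⇒≥ x≮v) (ℕₚ.<⇒≤ x<y)) x<xs)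
  = subst (ℤ._≤ + 1) (sym (ℤₚ.+-identityʳ _)) (lt-anti {0} {x} (suc v) z≤n)

-- Periodic words

period : ℕ → ℕ → List ℕ → List ℕ
period m k s = concat (map (λ j → shiftRow (j * m) s) (upTo k))

-- Splitting off the first copy leaves a single shift by `m`, so induction on `k` replaces `v` by
-- `v ∸ m`.
period-suc : ∀ m k s → period m (suc k) s ≡ s ++ shiftRow m (period m k s)
period-suc m k s = cong₂ _++_ (Listₚ.map-id s) (begin
  concat (map (λ j → shiftRow (j * m) s) (applyUpTo suc k))
    ≡⟨ cong (λ l → concat (map (λ j → shiftRow (j * m) s) l)) (Listₚ.map-upTo suc k) ⟨
  concat (map (λ j → shiftRow (j * m) s) (map suc (upTo k)))
    ≡⟨ cong concat (Listₚ.map-∘ (upTo k)) ⟨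
  concat (map (λ j → shiftRow (suc j * m) s) (upTo k))
    ≡⟨ cong concat (Listₚ.map-cong
         (λ j → trans (Listₚ.map-cong (ℕₚ.+-assoc m (j * m)) s) (Listₚ.map-∘ s)) (upTo k)) ⟩
  concat (map (λ j → shiftRow m (shiftRow (j * m) s)) (upTo k))
    ≡⟨ cong concat (Listₚ.map-∘ (upTo k)) ⟩
  concat (map (shiftRow m) (map (λ j → shiftRow (j * m) s) (upTo k)))
    ≡⟨ Listₚ.concat-map (map (λ j → shiftRow (j * m) s) (upTo k)) ⟩
  shiftRow m (period m k s) ∎)
  where open ≡-Reasoning

period-[] : ∀ m k → period m k [] ≡ []
period-[] m zero    = refl
period-[] m (suc k) = trans (period-suc m k []) (cong (shiftRow m) (period-[] m k))

cnt-period-suc : ∀ m k s v → cnt (period m (suc k) s) v ≡ cnt s v ℤ.+ cnt (period m k s) (v ∸ m)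
cnt-period-suc m k s v =
  trans (cong (λ l → cnt l v) (period-suc m k s))
    (trans (cnt-++ s (shiftRow m (period m k s)) v)
      (cong (ℤ._+_ (cnt s v)) (cnt-shift m (period m k s) v)))

period-length : ∀ m k s → length (period m k s) ≡ k * length s
period-length m zero    s = refl
period-length m (suc k) s =
  trans (cong length (period-suc m k s))
    (trans (Listₚ.length-++ s)
      (cong (_+_ (length s)) (trans (Listₚ.length-map (_+_ m) (period m k s)) (period-length m k s))))

period-≤ : ∀ {m} k {s} → All (_≤ m) s → All (_≤ k * m) (period m k s)
period-≤ zero    hs = []
period-≤ {m} (suc k) {s} hs =
  subst (All (_≤ suc k * m)) (sym (period-suc m k s))
    (Allₚ.++⁺ (All.map (λ h → ℕₚ.≤-trans h (ℕₚ.m≤m+n m (k * m))) hs)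
      (Allₚ.map⁺ (All.map (ℕₚ.+-monoʳ-≤ m) (period-≤ k hs))))

period-≥1 : ∀ {m} k {s} → All (1 ≤_) s → All (1 ≤_) (period m k s)
period-≥1 zero    hs = []
period-≥1 {m} (suc k) {s} hs =
  subst (All (1 ≤_)) (sym (period-suc m k s))
    (Allₚ.++⁺ hs (Allₚ.map⁺ (All.map (λ h → ℕₚ.≤-trans h (ℕₚ.m≤n+m _ m)) (period-≥1 k hs))))

period-sorted : ∀ {m} k {s} → All (_≤ m) s → Sorted s → Sorted (period m k s)
period-sorted zero    hs ss = []
period-sorted {m} (suc k) {s} hs ss =
  subst Sorted (sym (period-suc m k s))
    (AllPairsₚ.++⁺ ss
      (AllPairsₚ.map⁺ (AllPairs.map (ℕₚ.+-monoʳ-≤ m) (period-sorted k hs ss)))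
      (All.map (λ h → Allₚ.map⁺ (All.universal (λ y → ℕₚ.≤-trans h (ℕₚ.m≤m+n m y)) _)) hs))

-- Sums over words, distinctness, and lists read by index

sumTo-cong : ∀ n {f g : ℕ → ℤ} → (∀ i → f i ≡ g i) → sumTo n f ≡ sumTo n g
sumTo-cong zero    h = refl
sumTo-cong (suc n) h = cong₂ ℤ._+_ (sumTo-cong n h) (h n)

sumTo-+ : ∀ n f g → sumTo n (λ i → f i ℤ.+ g i) ≡ sumTo n f ℤ.+ sumTo n g
sumTo-+ zero    f g = refl
sumTo-+ (suc n) f g =
  trans (cong (ℤ._+ (f n ℤ.+ g n)) (sumTo-+ n f g)) (swap (sumTo n f) (sumTo n g) (f n) (g n))
  where
  swap : ∀ a b c d → (a ℤ.+ b) ℤ.+ (c ℤ.+ d) ≡ (a ℤ.+ c) ℤ.+ (b ℤ.+ d)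
  swap = solve-∀

total-take : ∀ ws p v → total (nth [] ws) p v ≡ cnt (concat (take p ws)) v
total-take ws       zero    v = refl
total-take []       (suc p) v =
  trans (ℤₚ.+-identityʳ _)
    (trans (total-take [] p v) (cong (λ l → cnt (concat l) v) (Listₚ.take-[] p)))
total-take (w ∷ ws) (suc p) v =
  trans (sumTo-suc p (λ l → cnt (nth [] (w ∷ ws) l) v))
    (trans (cong (ℤ._+_ (cnt w v)) (total-take ws p v)) (sym (cnt-++ w (concat (take p ws)) v)))
  where
  sumTo-suc : ∀ n f → sumTo (suc n) f ≡ f 0 ℤ.+ sumTo n (λ i → f (suc i))
  sumTo-suc zero    f = ℤₚ.+-comm (+ 0) (f 0)
  sumTo-suc (suc n) f =
    trans (cong (ℤ._+ f (suc n)) (sumTo-suc n f)) (ℤₚ.+-assoc (f 0) _ (f (suc n)))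

-- The count of a permutation of 1, ..., m grows by at most one per step, and the words from `p` on
-- can only add to the growth of the first `p`.
total-distinct : ∀ ws m → concat ws ↭ map suc (upTo m) → ∀ p v →
                 total (nth [] ws) p (suc v) ℤ.≤ total (nth [] ws) p v ℤ.+ + 1
total-distinct ws m perm p v rewrite total-take ws p v | total-take ws p (suc v) =
  ≤-from-diff (strict ⊕ cnt-mono back (ℕₚ.n≤1+n v))
    (trans (eq (cnt front v) (cnt front (suc v)) (cnt back v) (cnt back (suc v)))
      (cong₂ (λ a b → ((a ℤ.+ + 1) ℤ.+ cnt back (suc v)) ℤ.- (b ℤ.+ cnt back v))
        (split v) (split (suc v))))
  where
  front back : List ℕ
  front = concat (take p ws)
  back  = concat (drop p ws)
  split : ∀ v → cnt front v ℤ.+ cnt back v ≡ cnt (concat ws) v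
  split v = trans (sym (cnt-++ front back v))
    (cong (λ l → cnt l v)
      (trans (Listₚ.concat-++ (take p ws) (drop p ws)) (cong concat (Listₚ.take++drop≡id p ws))))
  strict : cnt (concat ws) (suc v) ℤ.≤ cnt (concat ws) v ℤ.+ + 1
  strict rewrite cnt-↭ perm v | cnt-↭ perm (suc v) | Listₚ.map-upTo suc m =
    cnt-strict (AllPairsₚ.applyUpTo⁺₁ suc m (λ i<j _ → s≤s i<j)) v
  eq : ∀ a a′ b b′ → (a ℤ.+ + 1) ℤ.- a′ ≡ (((a ℤ.+ b) ℤ.+ + 1) ℤ.+ b′) ℤ.- ((a′ ℤ.+ b′) ℤ.+ b)
  eq = solve-∀

concat-↭ : ∀ {xss yss : List (List ℕ)} → xss ↭ yss → concat xss ↭ concat yss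
concat-↭ Perm.refl = Perm.refl
concat-↭ (Perm.prep xs p) = Permₚ.++⁺ˡ xs (concat-↭ p)
concat-↭ (Perm.swap {_} {yss} xs ys p) =
  Perm.trans (Permₚ.++⁺ˡ xs (Permₚ.++⁺ˡ ys (concat-↭ p))) (Permₚ.shifts xs ys)
concat-↭ (Perm.trans p q) = Perm.trans (concat-↭ p) (concat-↭ q)

nth-All : ∀ {a ℓ} {A : Set a} {P : A → Set ℓ} {d xs} → P d → All P xs → ∀ i → P (nth d xs i)
nth-All pd []       i       = pd
nth-All pd (p ∷ ps) zero    = p
nth-All pd (p ∷ ps) (suc i) = nth-All pd ps i

nth-All-< : ∀ {a ℓ} {A : Set a} {P : A → Set ℓ} {d xs} → All P xs → ∀ i → i < length xs → P (nth d xs i)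
nth-All-< (p ∷ ps) zero    h       = p
nth-All-< (p ∷ ps) (suc i) (s≤s h) = nth-All-< ps i h

nth-map : ∀ {a b} {A : Set a} {B : Set b} (f : A → B) {d e} xs i → i < length xs →
          nth e (map f xs) i ≡ f (nth d xs i)
nth-map f (x ∷ xs) zero    h       = refl
nth-map f (x ∷ xs) (suc i) (s≤s h) = nth-map f xs i h

nth-zipWith-drop : ∀ {a b} {A : Set a} {B : Set b} (f : A → A → B) {d e} xs i → suc i < length xs →
                   nth e (zipWith f xs (drop 1 xs)) i ≡ f (nth d xs i) (nth d xs (suc i))
nth-zipWith-drop f (x ∷ [])     i       (s≤s ())
nth-zipWith-drop f (x ∷ y ∷ xs) zero    h       = refl
nth-zipWith-drop f (x ∷ y ∷ xs) (suc i) (s≤s h) = nth-zipWith-drop f (y ∷ xs) i h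

sumFirst-suc : ∀ n xs → sumFirst (suc n) xs ℤ.- sumFirst n xs ≡ nth (+ 0) xs n
sumFirst-suc zero    []       = refl
sumFirst-suc (suc n) []       = refl
sumFirst-suc zero    (x ∷ xs) = eq x
  where
  eq : ∀ x → (x ℤ.+ + 0) ℤ.- + 0 ≡ x
  eq = solve-∀
sumFirst-suc (suc n) (x ∷ xs) = trans (eq x (sumFirst (suc n) xs) (sumFirst n xs)) (sumFirst-suc n xs)
  where
  eq : ∀ x a b → (x ℤ.+ a) ℤ.- (x ℤ.+ b) ≡ a ℤ.- b
  eq = solve-∀

-- The padding zeros are the lengths of the default empty rows of `nth`.
paddedShape-applyUpTo : ∀ b T (g : ℕ → ℤ) → length T ≤ b →
                        (∀ j → j < b → + length (nth [] T j) ≡ g j) →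
                        paddedShape b T ≡ applyUpTo g b
paddedShape-applyUpTo zero    []      g h e = refl
paddedShape-applyUpTo (suc b) []      g h e =
  cong₂ _∷_ (e 0 (s≤s z≤n))
    (paddedShape-applyUpTo b [] (λ j → g (suc j)) z≤n (λ j j<b → e (suc j) (s≤s j<b)))
paddedShape-applyUpTo (suc b) (R ∷ T) g (s≤s h) e =
  cong₂ _∷_ (e 0 (s≤s z≤n))
    (paddedShape-applyUpTo b T (λ j → g (suc j)) h (λ j j<b → e (suc j) (s≤s j<b)))

-- The constants cᵢ as largest gaps between two words

-- ℓ₁(P(UX)) − |X| is the maximum over v of #{y ∈ U : y < v} − #{x ∈ X : x < v}.
module TwoRows {U X : List ℕ} {r m : ℕ} (sU : Sorted U) (sX : Sorted X)
               (lU : length U ≡ r) (lX : length X ≡ r)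
               (U≤m : All (_≤ m) U) (X≤m : All (_≤ m) X)
               (1≤U : All (1 ≤_) U) (1≤X : All (1 ≤_) X) (simple : Simple U X) where

  excess : ℤ
  excess = + firstRowLength (P (U ++ X)) ℤ.- + r

  R′ X′ : List ℕ
  R′ = inserted U X
  X′ = bumped U X

  firstRow : firstRowLength (P (U ++ X)) ≡ length R′
  firstRow = trans (firstRow-nth (P (U ++ X))) (cong length
    (trans (cong (λ l → nth [] (P (U ++ l)) 0) (sym (Listₚ.++-identityʳ X)))
      (proj₁ (P-rows W sW (U ∷ X ∷ []) (λ _ _ → refl)) 0)))
    where
    W : ℕ → List ℕ
    W = nth [] (U ∷ X ∷ [])
    sW : ∀ p → Sorted (W p)
    sW = nth-All {P = Sorted} [] (sU ∷ sX ∷ [])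
    firstRow-nth : ∀ T → firstRowLength T ≡ length (nth [] T 0)
    firstRow-nth []      = refl
    firstRow-nth (_ ∷ _) = refl

  full : ∀ {l v} → All (_≤ m) l → m < v → cnt l v ≡ + length l
  full l≤m m<v = cnt-all (All.map (λ h → ℕₚ.≤-<-trans h m<v) l≤m)

  -- Beyond `m` all letters are counted, so this is conservation of letters, `excess` being the
  -- length of `R′` minus that of `X`.
  bumped-full : ∀ {v} → m < v → cnt X′ v ≡ cnt U v ℤ.- excess
  bumped-full {v} m<v =
    trans (eq (cnt R′ v) (cnt X′ v) (cnt U v) (cnt X v) (Ins-conserves (ins-Ins U X) v))
      (cong (ℤ._-_ (cnt U v)) (cong₂ ℤ._-_
        (trans (full (proj₁ (Ins-All (ins-Ins U X) U≤m X≤m)) m<v) (cong +_ (sym firstRow)))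
        (trans (full X≤m m<v) (cong +_ lX))))
    where
    eq : ∀ a b c d → a ℤ.+ b ≡ c ℤ.+ d → b ≡ c ℤ.- (a ℤ.- d)
    eq a b c d h = trans (cancel a b) (trans (cong (ℤ._- a) h) (eq′ a c d))
      where
      cancel : ∀ a b → b ≡ (a ℤ.+ b) ℤ.- a
      cancel = solve-∀
      eq′ : ∀ a c d → (c ℤ.+ d) ℤ.- a ≡ c ℤ.- (a ℤ.- d)
      eq′ = solve-∀

  excess-bound : ∀ v → cnt U v ℤ.≤ cnt X v ℤ.+ excess
  excess-bound v =
    ≤-from-diff
      -- `v + suc m` is at least `v` and beyond all entries.
      (Ins-increments (ins-Ins U X) (ℕₚ.m≤m+n v (suc m))
        ⊕ Ins-dominated (ins-Ins U X) v
        ⊕ ℤₚ.≤-reflexive (sym (bumped-full (ℕₚ.m≤n+m (suc m) v))))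
      (eq (cnt X′ (v + suc m)) (cnt U v) (cnt X′ v) (cnt U (v + suc m)) (cnt X v) excess)
    where
    eq : ∀ a b c d x e →
         (x ℤ.+ e) ℤ.- b ≡ (((c ℤ.+ d) ℤ.+ x) ℤ.+ a) ℤ.- (((a ℤ.+ b) ℤ.+ c) ℤ.+ (d ℤ.- e))
    eq = solve-∀

  -- The minimiser for the full bumped word. The window from 1 to `suc m` is one period, so its
  -- translates by multiples of `m` run through the copies one by one.
  excess-attained : ∃[ a ] 1 ≤ a × a ≤ suc m × cnt U a ≡ cnt X a ℤ.+ excess
  excess-attained with Ins-attained (ins-Ins U X) sU sX simple (suc m)
  ... | u , u≤ , e = positive u u≤ tight
    where
    tight : cnt U u ≡ cnt X u ℤ.+ excess
    tight = eq (cnt X′ (suc m)) (cnt U u) (cnt X u) (cnt U (suc m)) excess e (bumped-full ℕₚ.≤-refl)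
      where
      eq : ∀ a b c d e → a ℤ.+ b ≡ c ℤ.+ d → a ≡ d ℤ.- e → b ≡ c ℤ.+ e
      eq a b c d e h refl = trans (cancel b d e) (trans (cong (ℤ._- (d ℤ.- e)) h) (eq′ c d e))
        where
        cancel : ∀ b d e → b ≡ ((d ℤ.- e) ℤ.+ b) ℤ.- (d ℤ.- e)
        cancel = solve-∀
        eq′ : ∀ c d e → (c ℤ.+ d) ℤ.- (d ℤ.- e) ≡ c ℤ.+ e
        eq′ = solve-∀
    positive : ∀ u → u ≤ suc m → cnt U u ≡ cnt X u ℤ.+ excess →
               ∃[ a ] 1 ≤ a × a ≤ suc m × cnt U a ≡ cnt X a ℤ.+ excess
    positive (suc u) u≤ h = suc u , s≤s z≤n , u≤ , h
    -- No entry is below 1, so 0 and 1 give the same counts.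
    positive zero    _  h = 1 , ℕₚ.≤-refl , s≤s z≤n ,
      trans (cnt-none 1≤U) (trans (sym (cnt-zero U)) (trans h
        (cong (ℤ._+ excess) (trans (cnt-zero X) (sym (cnt-none 1≤X))))))

-- Repeating all words periodically, and the resulting shape

module Powers (ws : List (List ℕ)) (m r k : ℕ)
              (ws-sorted : All Sorted ws) (ws-length : All (λ s → length s ≡ r) ws)
              (ws-≤ : All (All (_≤ m)) ws) (ws-≥1 : All (All (1 ≤_)) ws)
              (ws-↭ : concat ws ↭ map suc (upTo m)) (b-1≤k : length ws ∸ 1 ≤ k) where

  b : ℕ
  b = length ws

  s : ℕ → List ℕ
  s = nth [] ws

  s-sorted : ∀ q → Sorted (s q)
  s-sorted = nth-All {P = Sorted} [] ws-sorted

  s-≤ : ∀ q → All (_≤ m) (s q)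
  s-≤ = nth-All {P = All (_≤ m)} [] ws-≤

  s-≥1 : ∀ q → All (1 ≤_) (s q)
  s-≥1 = nth-All {P = All (1 ≤_)} [] ws-≥1

  s-length : ∀ q → q < b → length (s q) ≡ r
  s-length = nth-All-< {P = λ s → length s ≡ r} ws-length

  s-distinct : ∀ p v → total s p (suc v) ℤ.≤ total s p v ℤ.+ + 1
  s-distinct = total-distinct ws m ws-↭

  s-simple : ∀ q → Simple (s q) (s (suc q))
  s-simple q v =
    ≤-from-diff (s-distinct (suc (suc q)) v ⊕ total-mono q)
      (eq (total s q v) (total s q (suc v)) (cnt (s q) v) (cnt (s q) (suc v))
        (cnt (s (suc q)) v) (cnt (s (suc q)) (suc v)))
    where
    total-mono : ∀ q → total s q v ℤ.≤ total s q (suc v)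
    total-mono zero    = ℤₚ.≤-refl
    total-mono (suc q) = total-mono q ⊕ cnt-mono (s q) (ℕₚ.n≤1+n v)
    eq : ∀ T T′ a a′ b b′ → ((a ℤ.+ b) ℤ.+ + 1) ℤ.- (a′ ℤ.+ b′) ≡
         ((((T ℤ.+ a) ℤ.+ b) ℤ.+ + 1) ℤ.+ T′) ℤ.- (((T′ ℤ.+ a′) ℤ.+ b′) ℤ.+ T)
    eq = solve-∀

  s-after : ∀ q {v} → m < v → cnt (s q) v ≡ + length (s q)
  s-after q m<v = cnt-all (All.map (λ h → ℕₚ.≤-<-trans h m<v) (s-≤ q))

  W : ℕ → ℕ → List ℕ
  W k q = period m k (s q)

  W-before : ∀ k q {v} → v ≤ 1 → cnt (W k q) v ≡ + 0
  W-before k q v≤1 = cnt-none (All.map (ℕₚ.≤-trans v≤1) (period-≥1 k (s-≥1 q)))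

  -- The second copy starts above `suc m` at the earliest, or at it, and `cnt` is strict. At `suc m`
  -- itself `W-later` applies as well.
  W-first : ∀ k q {v} → v ≤ suc m → cnt (W (suc k) q) v ≡ cnt (s q) v
  W-first k q {v} v≤ =
    trans (cnt-period-suc m k (s q) v)
      (trans (cong (ℤ._+_ (cnt (s q) v)) (W-before k q (∸≤1 v≤))) (ℤₚ.+-identityʳ _))
    where
    ∸≤1 : v ≤ suc m → v ∸ m ≤ 1
    ∸≤1 h = ℕₚ.≤-trans (ℕₚ.∸-monoˡ-≤ m h) (ℕₚ.≤-reflexive (ℕₚ.m+n∸n≡m 1 m))

  W-later : ∀ k q {v} → m < v → q < b → cnt (W (suc k) q) v ≡ + r ℤ.+ cnt (W k q) (v ∸ m)
  W-later k q {v} m<v q<b =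
    trans (cnt-period-suc m k (s q) v)
      (cong (λ n → n ℤ.+ cnt (W k q) (v ∸ m)) (trans (s-after q m<v) (cong +_ (s-length q q<b))))

  W-sorted : ∀ k q → Sorted (W k q)
  W-sorted k q = period-sorted k (s-≤ q) (s-sorted q)

  W-total-suc : ∀ k p v → total (W (suc k)) p v ≡ total s p v ℤ.+ total (W k) p (v ∸ m)
  W-total-suc k p v =
    trans (sumTo-cong p (λ q → cnt-period-suc m k (s q) v))
      (sumTo-+ p (λ q → cnt (s q) v) (λ q → cnt (W k q) (v ∸ m)))

  -- Different copies use disjoint ranges of values, so the step from `v` to `suc v` concerns the
  -- first copy if `v ≤ m` and only later copies otherwise.
  W-distinct : ∀ k p v → total (W k) p (suc v) ℤ.≤ total (W k) p v ℤ.+ + 1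
  W-distinct zero    p v = ≤-from-diff (ℤ.+≤+ (z≤n {1}))
    (cong₂ ℤ._-_ (cong (ℤ._+ + 1) (empty p v)) (empty p (suc v)))
    where
    empty : ∀ p v → total (W zero) p v ≡ + 0
    empty zero    v = refl
    empty (suc p) v = trans (ℤₚ.+-identityʳ _) (empty p v)
  W-distinct (suc k) p v with v ≤? m
  ... | yes v≤m
    rewrite sumTo-cong p (λ q → W-first k q {suc v} (s≤s v≤m))
          | sumTo-cong p (λ q → W-first k q {v} (ℕₚ.m≤n⇒m≤1+n v≤m)) = s-distinct p v
  ... | no v≰m
    rewrite W-total-suc k p v | W-total-suc k p (suc v)
          | ℕₚ.+-∸-assoc 1 (ℕₚ.<⇒≤ (ℕₚ.≰⇒> v≰m))
          | sumTo-cong p (λ q → trans (s-after q {suc v} (ℕₚ.m<n⇒m<1+n (ℕₚ.≰⇒> v≰m)))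
                                (sym (s-after q {v} (ℕₚ.≰⇒> v≰m)))) =
    subst (total s p v ℤ.+ total (W k) p (suc (v ∸ m)) ℤ.≤_)
      (sym (ℤₚ.+-assoc (total s p v) (total (W k) p (v ∸ m)) (+ 1)))
      (ℤₚ.+-monoʳ-≤ (total s p v) (W-distinct k p (v ∸ m)))

  -- Complete copies contribute `r` to both sides and cancel.
  W-gap : ∀ {q c} → suc q < b → (∀ v → cnt (s q) v ℤ.≤ cnt (s (suc q)) v ℤ.+ c) →
          ∀ k v → cnt (W k q) v ℤ.≤ cnt (W k (suc q)) v ℤ.+ c
  -- Without copies the claim is that `c` is nonnegative, which is `h` at 0.
  W-gap {q} {c} q<b h zero    v =
    subst₂ (λ x y → x ℤ.≤ y ℤ.+ c) (cnt-zero (s q)) (cnt-zero (s (suc q))) (h 0)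
  W-gap {q} {c} q<b h (suc k) v with v ≤? suc m
  ... | yes v≤ rewrite W-first k q v≤ | W-first k (suc q) v≤ = h v
  ... | no v≰
    rewrite W-later k q (ℕₚ.<⇒≤ (ℕₚ.≰⇒> v≰)) (ℕₚ.<⇒≤ q<b) | W-later k (suc q) (ℕₚ.<⇒≤ (ℕₚ.≰⇒> v≰)) q<b =
    subst (+ r ℤ.+ cnt (W k q) (v ∸ m) ℤ.≤_) (sym (ℤₚ.+-assoc (+ r) (cnt (W k (suc q)) (v ∸ m)) c))
      (ℤₚ.+-monoʳ-≤ (+ r) (W-gap q<b h k (v ∸ m)))

  -- The `n` complete copies cancel, and `n < k` ensures that the copy after them, where the gap is
  -- attained, is present.
  W-tight : ∀ {q c a} → suc q < b → 1 ≤ a → a ≤ suc m → cnt (s q) a ≡ cnt (s (suc q)) a ℤ.+ c →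
            ∀ {k n} → n < k → cnt (W k q) (a + n * m) ≡ cnt (W k (suc q)) (a + n * m) ℤ.+ c
  W-tight {q} {c} {a} q<b 1≤a a≤ h {suc k} {zero} _
    rewrite ℕₚ.+-identityʳ a | W-first k q a≤ | W-first k (suc q) a≤ = h
  W-tight {q} {c} {a} q<b 1≤a a≤ h {suc k} {suc n} (s≤s n<k) =
    trans (later q (ℕₚ.<⇒≤ q<b))
      (trans (cong (ℤ._+_ (+ r)) (W-tight q<b 1≤a a≤ h n<k))
        (trans (sym (ℤₚ.+-assoc (+ r) (cnt (W k (suc q)) (a + n * m)) c))
          (cong (ℤ._+ c) (sym (later (suc q) q<b)))))
    where
    late : m < a + suc n * m
    late = ℕₚ.+-mono-≤ 1≤a (ℕₚ.m≤m+n m (n * m))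
    shift : a + suc n * m ∸ m ≡ a + n * m
    shift =
      trans (cong (_∸ m)
          (trans (cong (_+_ a) (ℕₚ.+-comm m (n * m))) (sym (ℕₚ.+-assoc a (n * m) m))))
              (ℕₚ.m+n∸n≡m (a + n * m) m)
    later : ∀ p → p < b → cnt (W (suc k) p) (a + suc n * m) ≡ + r ℤ.+ cnt (W k p) (a + n * m)
    later p p<b = trans (W-later k p late p<b) (cong (λ v → + r ℤ.+ cnt (W k p) v) shift)

  excess : List ℕ → List ℕ → ℤ
  excess u v = + firstRowLength (P (u ++ v)) ℤ.- + r

  C : ℕ → ℤ
  C n = sumFirst n (zipWith excess ws (drop 1 ws))

  C-suc : ∀ q → suc q < b → C (suc q) ℤ.- C q ≡ excess (s q) (s (suc q))
  C-suc q h = trans (sumFirst-suc q (zipWith excess ws (drop 1 ws))) (nth-zipWith-drop excess ws q h)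

  module Pair (q : ℕ) (h : suc q < b) =
    TwoRows (s-sorted q) (s-sorted (suc q)) (s-length q (ℕₚ.<⇒≤ h)) (s-length (suc q) h)
            (s-≤ q) (s-≤ (suc q)) (s-≥1 q) (s-≥1 (suc q)) (s-simple q)

  gap : ∀ q → suc q < b → ∀ v → cnt (W k q) v ℤ.≤ cnt (W k (suc q)) v ℤ.+ (C (suc q) ℤ.- C q)
  gap q h rewrite C-suc q h = W-gap h (Pair.excess-bound q h) k

  maximiser : ∀ q → ∃[ a ] 1 ≤ a × a ≤ suc m ×
              (suc q < b → cnt (s q) a ≡ cnt (s (suc q)) a ℤ.+ (C (suc q) ℤ.- C q))
  maximiser q with suc q <? b
  -- A dummy value where there is no pair, which makes `α` total and keeps it in the window.
  ... | no q≮b = 1 , ℕₚ.≤-refl , s≤s z≤n , λ h → contradiction h q≮b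
  ... | yes h with Pair.excess-attained q h
  ...   | a , 1≤a , a≤ , e =
    a , 1≤a , a≤ , λ _ → trans e (cong (ℤ._+_ (cnt (s (suc q)) a)) (sym (C-suc q h)))

  -- `α (suc q)` is a point where the words `q` and `suc q` differ most. The start `α 0` is the
  -- least point of the window.
  α : ℕ → ℕ
  α zero    = 1
  α (suc q) = proj₁ (maximiser q)

  1≤α : ∀ q → 1 ≤ α q
  1≤α zero    = ℕₚ.≤-refl
  1≤α (suc q) = proj₁ (proj₂ (maximiser q))

  α≤ : ∀ q → α q ≤ suc m
  α≤ zero    = s≤s z≤n
  α≤ (suc q) = proj₁ (proj₂ (proj₂ (maximiser q)))

  -- τ (suc q) is the first time from τ q on that is congruent to α (suc q) modulo m.
  laps : ℕ → ℕ
  laps zero    = 0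
  laps (suc q) with α q ≤? α (suc q)
  ... | yes _ = laps q
  ... | no  _ = suc (laps q)

  τ : ℕ → ℕ
  τ q = α q + laps q * m

  -- The first comparison costs no lap because `α 0` is 1, and each later one costs at most one.
  -- This saved lap is what makes `b ∸ 1` periods enough.
  laps≤ : ∀ q → laps (suc q) ≤ q
  laps≤ zero with 1 ≤? α 1
  ... | yes _   = z≤n
  ... | no  1≰α = contradiction (1≤α 1) 1≰α
  laps≤ (suc q) with α (suc q) ≤? α (suc (suc q))
  ... | yes _ = ℕₚ.m≤n⇒m≤1+n (laps≤ q)
  ... | no  _ = s≤s (laps≤ q)

  α-window : ∀ p q → α p ≤ α q + m
  α-window p q = ℕₚ.≤-trans (α≤ p) (ℕₚ.+-monoˡ-≤ m (1≤α q))

  τ-mono : ∀ q → τ q ≤ τ (suc q)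
  τ-mono q with α q ≤? α (suc q)
  ... | yes h = ℕₚ.+-monoˡ-≤ (laps q * m) h
  ... | no  _ = ℕₚ.≤-trans (ℕₚ.+-monoˡ-≤ (laps q * m) (α-window q (suc q)))
                  (ℕₚ.≤-reflexive (ℕₚ.+-assoc (α (suc q)) m (laps q * m)))

  τ-step : ∀ q → τ (suc q) ≤ τ q + m
  τ-step q with α q ≤? α (suc q)
  ... | yes _ = ℕₚ.≤-trans (ℕₚ.+-monoˡ-≤ (laps q * m) (α-window (suc q) q))
                  (ℕₚ.≤-reflexive (trans (ℕₚ.+-assoc (α q) m (laps q * m))
                    (trans (cong (_+_ (α q)) (ℕₚ.+-comm m (laps q * m)))
                      (sym (ℕₚ.+-assoc (α q) (laps q * m) m)))))
  ... | no  h = ℕₚ.≤-trans (ℕₚ.+-monoˡ-≤ (m + laps q * m) (ℕₚ.<⇒≤ (ℕₚ.≰⇒> h)))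
                  (ℕₚ.≤-reflexive (trans (cong (_+_ (α q)) (ℕₚ.+-comm m (laps q * m)))
                    (sym (ℕₚ.+-assoc (α q) (laps q * m) m))))

  tight : ∀ q j → suc q + j < b →
          cnt (W k q) (τ (suc q) + j * m) ≡
          cnt (W k (suc q)) (τ (suc q) + j * m) ℤ.+ (C (suc q) ℤ.- C q)
  tight q j h =
    subst (λ v → cnt (W k q) v ≡ cnt (W k (suc q)) v ℤ.+ (C (suc q) ℤ.- C q))
      (trans (cong (_+_ (α (suc q))) (ℕₚ.*-distribʳ-+ m (laps (suc q)) j))
        (sym (ℕₚ.+-assoc (α (suc q)) (laps (suc q) * m) (j * m))))
      -- The point lies in copy `laps (suc q) + j`, which is at most `q + j` and so below
      -- `b ∸ 1 ≤ k`. This is where the bound on `k` enters.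
      (W-tight q<b (1≤α (suc q)) (α≤ (suc q)) (proj₂ (proj₂ (proj₂ (maximiser q))) q<b)
        (ℕₚ.≤-<-trans (ℕₚ.+-monoˡ-≤ j (laps≤ q)) (ℕₚ.≤-trans (ℕₚ.∸-monoˡ-≤ 1 h) b-1≤k)))
    where
    q<b : suc q < b
    q<b = ℕₚ.≤-<-trans (s≤s (ℕₚ.m≤m+n q j)) h

  open RowInsertion (W k)
  open Distinct (W-sorted k) (W-distinct k)
  open Gaps C b gap
  open Steady τ m τ-mono τ-step tight

  row-length : ∀ j q → suc q + j ≡ b → + length (row (W k) b j) ≡ + (k * r) ℤ.+ (C q ℤ.- C j)
  row-length j q e = begin
    + length (row (W k) b j)
      ≡⟨ cnt-all (row-All below b j) ⟨
    cnt (row (W k) b j) N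
      ≡⟨ cong (λ b → cnt (row (W k) b j) N) e ⟨
    t (suc q + j) j N
      ≡⟨ row-steady j q (ℕₚ.≤-reflexive e) N (ℕₚ.m≤m+n (τ q + j * m) (suc (k * m))) ⟩
    w q N ℤ.+ (C q ℤ.- C j)
      ≡⟨ cong (ℤ._+ (C q ℤ.- C j)) full ⟩
    + (k * r) ℤ.+ (C q ℤ.- C j) ∎
    where
    open ≡-Reasoning
    N : ℕ
    -- Past the threshold of `row-steady` and past the largest possible entry `k * m`, so that `cnt`
    -- gives lengths.
    N = τ q + j * m + suc (k * m)
    q<b : q < b
    q<b = ℕₚ.≤-trans (s≤s (ℕₚ.m≤m+n q j)) (ℕₚ.≤-reflexive e)
    below : ∀ p → All (_< N) (W k p)
    below p =
      All.map (λ h → ℕₚ.≤-trans (s≤s h) (ℕₚ.m≤n+m (suc (k * m)) (τ q + j * m)))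
        (period-≤ k (s-≤ p))
    full : w q N ≡ + (k * r)
    full = trans (cnt-all (below q))
      (cong +_ (trans (period-length m k (s q)) (cong (_*_ k) (s-length q q<b))))

  shape-P : paddedShape b (P (concat (map (period m k) ws))) ≡
            map (λ j → (+ (k * r) ℤ.+ C (b ∸ 1 ∸ j)) ℤ.- C j) (upTo b)
  shape-P =
    trans (paddedShape-applyUpTo b T (λ j → (+ (k * r) ℤ.+ C (b ∸ 1 ∸ j)) ℤ.- C j)
        (subst (length T ≤_) len (proj₂ rows)) part)
      (sym (Listₚ.map-upTo (λ j → (+ (k * r) ℤ.+ C (b ∸ 1 ∸ j)) ℤ.- C j) b))
    where
    T : Tableau
    T = P (concat (map (period m k) ws))
    len : length (map (period m k) ws) ≡ b
    len = Listₚ.length-map (period m k) ws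
    rows : HasRows T (row (W k) (length (map (period m k) ws))) ×
           length T ≤ length (map (period m k) ws)
    rows = P-rows (W k) (W-sorted k) (map (period m k) ws)
      (λ i i< → nth-map (period m k) ws i (subst (i <_) len i<))
    index : ∀ n {j} → j < n → suc (n ∸ 1 ∸ j) + j ≡ n
    index (suc n) (s≤s j≤n) = cong suc (ℕₚ.m∸n+n≡m j≤n)
    part : ∀ j → j < b → + length (nth [] T j) ≡ (+ (k * r) ℤ.+ C (b ∸ 1 ∸ j)) ℤ.- C j
    part j j<b =
      trans (cong (λ l → + length l) (trans (proj₁ rows j) (cong (λ n → row (W k) n j) len)))
        (trans (row-length j (b ∸ 1 ∸ j) (index b j<b))
          (sym (ℤₚ.+-assoc (+ (k * r)) (C (b ∸ 1 ∸ j)) (ℤ.- C j))))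

-- From skew tableaux to words

theorem1p6 : (b r : ℕ) → 1 ≤ b → 1 ≤ r →
    (S : SkewTab) → IsStandardSkew S →
    length S ≡ b → All (λ R → length (proj₂ R) ≡ r) S →
    (k : ℕ) → b ∸ 1 ≤ k →
    paddedShape b (Rect (power k S)) ≡ lambdas b r k S
theorem1p6 b r _ _ S std refl rows-length k b-1≤k =
  -- `Powers` counts the words of the reversed list; the transport passes to `length S` and to the
  -- reading word of the power.
  subst₂ (λ n T → paddedShape n T ≡ lambdas n r k S)
    ws-count (cong P reading)
    (Powers.shape-P ws (size S) r k
      (reverse-rows (All.map
        (λ h → AllPairs.map ℕₚ.<⇒≤ (Linkedₚ.Linked⇒AllPairs ℕₚ.<-trans h)) rowsIncreasing))
      (reverse-rows rows-length)
      (ws-All (Allₚ.all-upTo (size S)))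
      (ws-All (All.universal (λ _ → s≤s z≤n) (upTo (size S))))
      ws-↭ (subst (λ n → n ∸ 1 ≤ k) (sym ws-count) b-1≤k))
  where
  open IsStandardSkew std
  ws : List (List ℕ)
  ws = wordsBottomUp S
  ws-count : length ws ≡ length S
  ws-count = trans (Listₚ.length-reverse (map proj₂ S)) (Listₚ.length-map proj₂ S)
  reverse-rows : ∀ {ℓ} {Q : List ℕ → Set ℓ} → All (λ R → Q (proj₂ R)) S → All Q ws
  reverse-rows h = Permₚ.All-resp-↭ (Perm.↭-sym (Permₚ.↭-reverse (map proj₂ S))) (Allₚ.map⁺ h)
  ws-↭ : concat ws ↭ map suc (upTo (size S))
  ws-↭ = Perm.trans (concat-↭ (Permₚ.↭-reverse (map proj₂ S))) filling
  ws-All : ∀ {ℓ} {Q : ℕ → Set ℓ} → All (λ i → Q (suc i)) (upTo (size S)) → All (All Q) ws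
  ws-All h = Allₚ.concat⁻ (Permₚ.All-resp-↭ (Perm.↭-sym ws-↭) (Allₚ.map⁺ h))
  -- Repetition acts on each row separately, so it commutes with reversing the order of the rows.
  reading : concat (map (period (size S) k) ws) ≡ readingWord (power k S)
  reading = cong concat (trans (Listₚ.reverse-map (period (size S) k) (map proj₂ S))
    (cong reverse (trans (sym (Listₚ.map-∘ S)) (Listₚ.map-∘ S))))
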